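{- Let $G$ be a finite simple connected graph that has no clique cutset and has no pair of comparable vertices. If $G$ is $(P_6,\text{diamond})$-free and $G$ is not perfect, then $\chi(G)\le \omega(G)+3$.
   Context: $P_6$ denotes the path on $6$ vertices. The diamond is the graph obtained from $K_4$ by removing one edge. A graph is $(H_1,H_2)$-free if it contains no induced subgraph isomorphic to $H_1$ or $H_2$. A clique cutset of $G$ is a set $K\subseteq V(G)$ inducing a clique such that $G-K$ has more connected components than $G$. Two non-adjacent vertices $u,v$ are comparable if $N(u)\subseteq N(v)$ or $N(v)\subseteq N(u)$, where $N(x)$ is the set of neighbours of $x$. A graph $G$ is perfect if $\chi(H)=\omega(H)$ for every induced subgraph $H$ of $G$. $\chi$ denotes chromatic number and $\omega$ clique number. -}

module Defs where

open import Data.Nat using (ℕ; _≤_; _+_)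
open import Data.Fin using (Fin; zero; suc)
open import Data.Bool using (Bool; true; false; _∧_; not)
open import Data.Product using (Σ; _×_; ∃; _,_)
open import Data.Sum using (_⊎_)
open import Relation.Binary.PropositionalEquality using (_≡_; _≢_; refl)
open import Relation.Nullary using (¬_)
open import Function.Definitions using (Injective)

record Graph (n : ℕ) : Set where
  field
    adj    : Fin n → Fin n → Bool
    sym    : ∀ i j → adj i j ≡ adj j i
    irrefl : ∀ i → adj i i ≡ false
open Graph public

Adj : ∀ {n} → Graph n → Fin n → Fin n → Set
Adj G u v = adj G u v ≡ true

-- Subgraph of G induced by (the image of) a map f : Fin m → Fin n
-- (used with injective f, so the image has m vertices).
induce : ∀ {n m} → Graph n → (Fin m → Fin n) → Graph m
induce G f = record
  { adj = λ i j → adj G (f i) (f j)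
  ; sym = λ i j → sym G (f i) (f j)
  ; irrefl = λ i → irrefl G (f i) }

ContainsInduced : ∀ {n m} → Graph n → Graph m → Set
ContainsInduced {n} {m} G H =
  Σ (Fin m → Fin n) λ f → Injective _≡_ _≡_ f × (∀ i j → adj H i j ≡ adj G (f i) (f j))

Free₂ : ∀ {n a b} → Graph a → Graph b → Graph n → Set
Free₂ H₁ H₂ G = ¬ ContainsInduced G H₁ × ¬ ContainsInduced G H₂

data PathIn {n} (G : Graph n) (S : Fin n → Bool) : Fin n → Fin n → Set where
  here : ∀ {u} → S u ≡ true → PathIn G S u u
  step : ∀ {u w v} → S u ≡ true → Adj G u w → PathIn G S w v → PathIn G S u v

Connected : ∀ {n} → Graph n → Set
Connected G = ∀ u v → PathIn G (λ _ → true) u v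

IsCliqueSet : ∀ {n} → Graph n → (Fin n → Bool) → Set
IsCliqueSet G K = ∀ u v → K u ≡ true → K v ≡ true → u ≢ v → Adj G u v

-- K is a clique cutset: K is a clique and G - K has more components than G,
-- i.e. some two vertices outside K lie in a common component of G but in
-- different components of G - K.
IsCliqueCutset : ∀ {n} → Graph n → (Fin n → Bool) → Set
IsCliqueCutset G K = IsCliqueSet G K ×
  Σ _ λ u → Σ _ λ v → K u ≡ false × K v ≡ false ×
    PathIn G (λ _ → true) u v × ¬ PathIn G (λ x → not (K x)) u v

HasCliqueCutset : ∀ {n} → Graph n → Set
HasCliqueCutset G = ∃ λ K → IsCliqueCutset G K

NbhdSub : ∀ {n} → Graph n → Fin n → Fin n → Set
NbhdSub G u v = ∀ w → Adj G u w → Adj G v w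

ComparablePair : ∀ {n} → Graph n → Fin n → Fin n → Set
ComparablePair G u v = u ≢ v × adj G u v ≡ false × (NbhdSub G u v ⊎ NbhdSub G v u)

HasComparablePair : ∀ {n} → Graph n → Set
HasComparablePair G = ∃ λ u → ∃ λ v → ComparablePair G u v

HasClique : ∀ {n} → Graph n → ℕ → Set
HasClique {n} G k = Σ (Fin k → Fin n) λ f →
  Injective _≡_ _≡_ f × (∀ i j → i ≢ j → Adj G (f i) (f j))

IsCliqueNumber : ∀ {n} → Graph n → ℕ → Set
IsCliqueNumber G w = HasClique G w × (∀ k → HasClique G k → k ≤ w)

Colorable : ∀ {n} → Graph n → ℕ → Set
Colorable {n} G k = Σ (Fin n → Fin k) λ c → ∀ u v → Adj G u v → c u ≢ c v

IsChromaticNumber : ∀ {n} → Graph n → ℕ → Set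
IsChromaticNumber G c = Colorable G c × (∀ k → Colorable G k → c ≤ k)

Perfect : ∀ {n} → Graph n → Set
Perfect {n} G = ∀ m (f : Fin m → Fin n) → Injective _≡_ _≡_ f →
  ∀ c w → IsChromaticNumber (induce G f) c → IsCliqueNumber (induce G f) w → c ≡ w

P6-adj : Fin 6 → Fin 6 → Bool
P6-adj zero zero = false
P6-adj zero (suc zero) = true
P6-adj zero (suc (suc zero)) = false
P6-adj zero (suc (suc (suc zero))) = false
P6-adj zero (suc (suc (suc (suc zero)))) = false
P6-adj zero (suc (suc (suc (suc (suc zero))))) = false
P6-adj (suc zero) zero = true
P6-adj (suc zero) (suc zero) = false
P6-adj (suc zero) (suc (suc zero)) = true
P6-adj (suc zero) (suc (suc (suc zero))) = false
P6-adj (suc zero) (suc (suc (suc (suc zero)))) = false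
P6-adj (suc zero) (suc (suc (suc (suc (suc zero))))) = false
P6-adj (suc (suc zero)) zero = false
P6-adj (suc (suc zero)) (suc zero) = true
P6-adj (suc (suc zero)) (suc (suc zero)) = false
P6-adj (suc (suc zero)) (suc (suc (suc zero))) = true
P6-adj (suc (suc zero)) (suc (suc (suc (suc zero)))) = false
P6-adj (suc (suc zero)) (suc (suc (suc (suc (suc zero))))) = false
P6-adj (suc (suc (suc zero))) zero = false
P6-adj (suc (suc (suc zero))) (suc zero) = false
P6-adj (suc (suc (suc zero))) (suc (suc zero)) = true
P6-adj (suc (suc (suc zero))) (suc (suc (suc zero))) = false
P6-adj (suc (suc (suc zero))) (suc (suc (suc (suc zero)))) = true
P6-adj (suc (suc (suc zero))) (suc (suc (suc (suc (suc zero))))) = false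
P6-adj (suc (suc (suc (suc zero)))) zero = false
P6-adj (suc (suc (suc (suc zero)))) (suc zero) = false
P6-adj (suc (suc (suc (suc zero)))) (suc (suc zero)) = false
P6-adj (suc (suc (suc (suc zero)))) (suc (suc (suc zero))) = true
P6-adj (suc (suc (suc (suc zero)))) (suc (suc (suc (suc zero)))) = false
P6-adj (suc (suc (suc (suc zero)))) (suc (suc (suc (suc (suc zero))))) = true
P6-adj (suc (suc (suc (suc (suc zero))))) zero = false
P6-adj (suc (suc (suc (suc (suc zero))))) (suc zero) = false
P6-adj (suc (suc (suc (suc (suc zero))))) (suc (suc zero)) = false
P6-adj (suc (suc (suc (suc (suc zero))))) (suc (suc (suc zero))) = false
P6-adj (suc (suc (suc (suc (suc zero))))) (suc (suc (suc (suc zero)))) = true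
P6-adj (suc (suc (suc (suc (suc zero))))) (suc (suc (suc (suc (suc zero))))) = false

P6-sym : ∀ i j → P6-adj i j ≡ P6-adj j i
P6-sym zero zero = refl
P6-sym zero (suc zero) = refl
P6-sym zero (suc (suc zero)) = refl
P6-sym zero (suc (suc (suc zero))) = refl
P6-sym zero (suc (suc (suc (suc zero)))) = refl
P6-sym zero (suc (suc (suc (suc (suc zero))))) = refl
P6-sym (suc zero) zero = refl
P6-sym (suc zero) (suc zero) = refl
P6-sym (suc zero) (suc (suc zero)) = refl
P6-sym (suc zero) (suc (suc (suc zero))) = refl
P6-sym (suc zero) (suc (suc (suc (suc zero)))) = refl
P6-sym (suc zero) (suc (suc (suc (suc (suc zero))))) = refl
P6-sym (suc (suc zero)) zero = refl
P6-sym (suc (suc zero)) (suc zero) = refl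
P6-sym (suc (suc zero)) (suc (suc zero)) = refl
P6-sym (suc (suc zero)) (suc (suc (suc zero))) = refl
P6-sym (suc (suc zero)) (suc (suc (suc (suc zero)))) = refl
P6-sym (suc (suc zero)) (suc (suc (suc (suc (suc zero))))) = refl
P6-sym (suc (suc (suc zero))) zero = refl
P6-sym (suc (suc (suc zero))) (suc zero) = refl
P6-sym (suc (suc (suc zero))) (suc (suc zero)) = refl
P6-sym (suc (suc (suc zero))) (suc (suc (suc zero))) = refl
P6-sym (suc (suc (suc zero))) (suc (suc (suc (suc zero)))) = refl
P6-sym (suc (suc (suc zero))) (suc (suc (suc (suc (suc zero))))) = refl
P6-sym (suc (suc (suc (suc zero)))) zero = refl
P6-sym (suc (suc (suc (suc zero)))) (suc zero) = refl
P6-sym (suc (suc (suc (suc zero)))) (suc (suc zero)) = refl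
P6-sym (suc (suc (suc (suc zero)))) (suc (suc (suc zero))) = refl
P6-sym (suc (suc (suc (suc zero)))) (suc (suc (suc (suc zero)))) = refl
P6-sym (suc (suc (suc (suc zero)))) (suc (suc (suc (suc (suc zero))))) = refl
P6-sym (suc (suc (suc (suc (suc zero))))) zero = refl
P6-sym (suc (suc (suc (suc (suc zero))))) (suc zero) = refl
P6-sym (suc (suc (suc (suc (suc zero))))) (suc (suc zero)) = refl
P6-sym (suc (suc (suc (suc (suc zero))))) (suc (suc (suc zero))) = refl
P6-sym (suc (suc (suc (suc (suc zero))))) (suc (suc (suc (suc zero)))) = refl
P6-sym (suc (suc (suc (suc (suc zero))))) (suc (suc (suc (suc (suc zero))))) = refl

P6-irr : ∀ i → P6-adj i i ≡ false
P6-irr zero = refl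
P6-irr (suc zero) = refl
P6-irr (suc (suc zero)) = refl
P6-irr (suc (suc (suc zero))) = refl
P6-irr (suc (suc (suc (suc zero)))) = refl
P6-irr (suc (suc (suc (suc (suc zero))))) = refl

P6 : Graph 6
P6 = record { adj = P6-adj ; sym = P6-sym ; irrefl = P6-irr }

diamond-adj : Fin 4 → Fin 4 → Bool
diamond-adj zero zero = false
diamond-adj zero (suc zero) = true
diamond-adj zero (suc (suc zero)) = true
diamond-adj zero (suc (suc (suc zero))) = true
diamond-adj (suc zero) zero = true
diamond-adj (suc zero) (suc zero) = false
diamond-adj (suc zero) (suc (suc zero)) = true
diamond-adj (suc zero) (suc (suc (suc zero))) = true
diamond-adj (suc (suc zero)) zero = true
diamond-adj (suc (suc zero)) (suc zero) = true
diamond-adj (suc (suc zero)) (suc (suc zero)) = false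
diamond-adj (suc (suc zero)) (suc (suc (suc zero))) = false
diamond-adj (suc (suc (suc zero))) zero = true
diamond-adj (suc (suc (suc zero))) (suc zero) = true
diamond-adj (suc (suc (suc zero))) (suc (suc zero)) = false
diamond-adj (suc (suc (suc zero))) (suc (suc (suc zero))) = false

diamond-sym : ∀ i j → diamond-adj i j ≡ diamond-adj j i
diamond-sym zero zero = refl
diamond-sym zero (suc zero) = refl
diamond-sym zero (suc (suc zero)) = refl
diamond-sym zero (suc (suc (suc zero))) = refl
diamond-sym (suc zero) zero = refl
diamond-sym (suc zero) (suc zero) = refl
diamond-sym (suc zero) (suc (suc zero)) = refl
diamond-sym (suc zero) (suc (suc (suc zero))) = refl
diamond-sym (suc (suc zero)) zero = refl
diamond-sym (suc (suc zero)) (suc zero) = refl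
diamond-sym (suc (suc zero)) (suc (suc zero)) = refl
diamond-sym (suc (suc zero)) (suc (suc (suc zero))) = refl
diamond-sym (suc (suc (suc zero))) zero = refl
diamond-sym (suc (suc (suc zero))) (suc zero) = refl
diamond-sym (suc (suc (suc zero))) (suc (suc zero)) = refl
diamond-sym (suc (suc (suc zero))) (suc (suc (suc zero))) = refl

diamond-irr : ∀ i → diamond-adj i i ≡ false
diamond-irr zero = refl
diamond-irr (suc zero) = refl
diamond-irr (suc (suc zero)) = refl
diamond-irr (suc (suc (suc zero))) = refl

diamond : Graph 4
diamond = record { adj = diamond-adj ; sym = diamond-sym ; irrefl = diamond-irr }

{-# OPTIONS --safe #-}
-- Diamond-freeness makes every neighbourhood a disjoint union of cliques. If ω ≥ 4 and K is a maximum
-- clique, then all but at most two vertices of K have a triangle-free neighbourhood off K (else P₆ or a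
-- clique cutset appears), and for ω = 3 this is trivial; so there is an edge k₁k₂ both of whose ends have
-- triangle-free private neighbourhoods, which take two colours each. Let W be the set of vertices adjacent
-- to neither end. By P₆-freeness no induced P₄ leads from a private neighbour x into W, so in a component
-- C of W attached to x the non-neighbours of x form disjoint cliques. Up to vertices that can be coloured
-- greedily, C is then 3-colourable with two new colours and one of the four old ones, unless six pairwise
-- non-adjacent private neighbours are attached to C; in that case C contains no odd cycle. Together with
-- the ω − 3 further colours needed for the common neighbours of k₁ and k₂ this makes ω + 3 colours.
module Submission where

open import Defs
open import Data.Nat using (ℕ; zero; suc; _≤_; _<_; _+_; z≤n; s≤s)
open import Data.Nat.Properties using (≤-refl; ≤-trans; m≤n⇒m≤1+n; 1+n≰n; _≤?_; +-comm)
open import Data.Bool using (Bool; true; false; _∧_; _∨_; not; if_then_else_)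
import Data.Bool.Properties as Bool
open import Data.Fin using (Fin; zero; suc; punchIn; _↑ʳ_) renaming (_<_ to _<ᶠ_)
open import Data.Fin.Patterns
open import Data.Fin.Properties using (_≟_; any?; all?; ¬∀⟶∃¬; pigeonhole; punchIn-injective; punchInᵢ≢i; ↑ʳ-injective)
open import Data.Maybe using (Maybe; just; nothing; fromMaybe; is-just)
open import Data.Maybe.Properties using (just-injective)
open import Data.List using (List; []; _∷_; allFin; length; lookup)
open import Data.List.Membership.Propositional using (_∈_)
open import Data.List.Membership.Propositional.Properties using (∈-allFin; ∈-lookup)
open import Data.List.Relation.Unary.Any using (here; there)
open import Data.List.Relation.Unary.All as All using (All; []; _∷_)
open import Data.List.Relation.Unary.AllPairs using (AllPairs; []; _∷_)
open import Data.Product using (Σ; ∃; _×_; _,_; proj₁; proj₂)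
open import Data.Sum using (_⊎_; inj₁; inj₂; [_,_])
open import Data.Empty using (⊥; ⊥-elim)
open import Data.Unit using (tt)
open import Function using (_∘_; id; case_of_; _∋_)
open import Function.Definitions using (Injective)
open import Relation.Nullary using (¬_; Dec; yes; no; does)
open import Relation.Nullary.Decidable using (¬¬-excluded-middle; decidable-stable; toWitness; _×-dec_; _→-dec_; dec-true; dec-false)
open import Relation.Binary.PropositionalEquality as ≡ using (_≡_; _≢_; refl; trans; cong; cong₂; subst)

-- Classical reasoning takes place inside double negation: the bound on χ is decidable.

-- The count behind ω + 3 = 6 + p, where ω = 3 + p: two colours for the far vertices, two for each
-- private side, and 1 + p for the common neighbours of the edge make 7 + p, one too many. One
-- private colour is therefore shared with the common neighbours, which diamond-freeness allows
-- because no common neighbour is adjacent to a private one. The price is that the shared colour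
-- cannot be reused safely in a component `C`, whose vertices may see a common neighbour. Three old
-- colours remain as a third colour for `C`. If none of them works, each is borne by two attached
-- vertices, and these six are more than the five edges of a 5-cycle. Greedy colouring works at a
-- vertex whose neighbours, apart from three colours, form a clique: that clique has at most ω - 1
-- vertices, so at most ω + 2 colours are seen. Three is a tight allowance. A vertex of `C` already
-- spends one on its common neighbour, since it has at most one, and so cannot ignore all four
-- private colours. The case distinctions on components all serve to save a colour here.

private variable
  A B : Set
  n : ℕ

return : A → ¬ ¬ A
return a k = k a

infixl 1 _>>=_
_>>=_ : ¬ ¬ A → (A → ¬ ¬ B) → ¬ ¬ B
(m >>= f) k = m λ a → f a k

em : (A : Set) → ¬ ¬ Dec A
em A = ¬¬-excluded-middle

¬¬-∀Fin : {P : Fin n → Set} → (∀ i → ¬ ¬ P i) → ¬ ¬ (∀ i → P i)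
¬¬-∀Fin {zero}  h = return λ ()
¬¬-∀Fin {suc n} h =
  h zero >>= λ p₀ → ¬¬-∀Fin (h ∘ suc) >>= λ p → return λ { zero → p₀ ; (suc i) → p i }

dec-pred : (P : Fin n → Set) → ¬ ¬ (∀ i → Dec (P i))
dec-pred P = ¬¬-∀Fin λ i → em (P i)

true⊎false : ∀ b → b ≡ true ⊎ b ≡ false
true⊎false true  = inj₁ refl
true⊎false false = inj₂ refl

true≢false : ∀ {b} → b ≡ true → b ≡ false → ⊥
true≢false refl ()

∧-split : ∀ {a b} → a ∧ b ≡ true → a ≡ true × b ≡ true
∧-split {true} p = refl , p

∧-pair : ∀ {a b} → a ≡ true → b ≡ true → a ∧ b ≡ true
∧-pair refl q = q

not-true : ∀ {b} → not b ≡ true → b ≡ false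
not-true {false} _ = refl

not-false : ∀ {b} → b ≡ false → not b ≡ true
not-false refl = refl

if-true : ∀ {b} {x y : A} → b ≡ true → (if b then x else y) ≡ x
if-true refl = refl

if-false : ∀ {b} {x y : A} → b ≡ false → (if b then x else y) ≡ y
if-false refl = refl

does-yes : (d : Dec A) → does d ≡ true → A
does-yes (yes a) _ = a

does-no : (d : Dec A) → does d ≡ false → ¬ A
does-no (no ¬a) _ = ¬a

pairwise : {R : A → A → Set} {xs : List A} → AllPairs R xs →
  ∀ i j → i <ᶠ j → R (lookup xs i) (lookup xs j)
pairwise (px ∷ _)   zero    (suc j) _         = All.lookup px (∈-lookup j)
pairwise (_  ∷ pxs) (suc i) (suc j) (s≤s i<j) = pairwise pxs i j i<j

-- Colouring by greedy extension

restrict : Graph n → (Fin n → Bool) → Graph n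
restrict G S = record
  { adj    = λ u v → S u ∧ (S v ∧ adj G u v)
  ; sym    = λ u v → trans (cong (S u ∧_) (cong (S v ∧_) (sym G u v)))
                           (∧-swap (S u) (S v) (adj G v u))
  ; irrefl = λ u → trans (cong (S u ∧_) (cong (S u ∧_) (irrefl G u)))
                         (∧-zero (S u) (S u)) }
  where
  ∧-swap : ∀ a b c → a ∧ (b ∧ c) ≡ b ∧ (a ∧ c)
  ∧-swap true  b     c = refl
  ∧-swap false true  c = refl
  ∧-swap false false c = refl
  ∧-zero : ∀ a b → a ∧ (b ∧ false) ≡ false
  ∧-zero false b     = refl
  ∧-zero true  true  = refl
  ∧-zero true  false = refl

module _ (G : Graph n) (S : Fin n → Bool) (u v : Fin n) where

  restrict-split : Adj (restrict G S) u v → S u ≡ true × S v ≡ true × Adj G u v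
  restrict-split p with ∧-split {S u} p
  ... | su , q with ∧-split {S v} q
  ... | sv , r = su , sv , r

  restrict-pair : S u ≡ true → S v ≡ true → Adj G u v → Adj (restrict G S) u v
  restrict-pair su sv r = ∧-pair su (∧-pair sv r)

Unseen : ∀ {k} → Graph n → (Fin n → Fin k) → Fin n → Set
Unseen G c v = ∃ λ γ → ∀ u → Adj G v u → c u ≢ γ

unseen⊎rainbow : ∀ {k} (G : Graph n) (c : Fin n → Fin k) v →
  Unseen G c v ⊎ (Σ (Fin k → Fin n) λ g → ∀ γ → Adj G v (g γ) × c (g γ) ≡ γ)
unseen⊎rainbow {k = k} G c v = case all? seen? of λ where
    (yes p) → inj₂ ((λ γ → proj₁ (p γ)) , λ γ → proj₂ (p γ))
    (no ¬p) → let γ , q = ¬∀⟶∃¬ k Seen seen? ¬p in inj₁ (γ , λ u a e → q (u , a , e))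
  where
  Seen : Fin k → Set
  Seen γ = ∃ λ u → Adj G v u × c u ≡ γ
  seen? : ∀ γ → Dec (Seen γ)
  seen? γ = any? λ u → (adj G v u Bool.≟ true) ×-dec (c u ≟ γ)

-- Colourings are total, so a vertex not yet reached carries a junk colour. Because `free` is
-- demanded for every total `c` that agrees with `c₀` on `P`, junk does no harm and the order of
-- extension is irrelevant.
module _ (G : Graph n) {k} (c₀ : Fin n → Fin k) (P : Fin n → Bool)
  (proper : ∀ u v → P u ≡ true → P v ≡ true → Adj G u v → c₀ u ≢ c₀ v)
  (free : ∀ v → P v ≡ false → ∀ c → (∀ u → P u ≡ true → c u ≡ c₀ u) → Unseen G c v) where

  private
    Done : List (Fin n) → Fin n → Set
    Done l u = P u ≡ true ⊎ u ∈ l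

    Partial : List (Fin n) → Set
    Partial l = Σ (Fin n → Fin k) λ c →
      (∀ u v → Done l u → Done l v → Adj G u v → c u ≢ c v) × (∀ u → P u ≡ true → c u ≡ c₀ u)

    partial : ∀ l → Partial l
    partial [] = c₀ , (λ { u v (inj₁ pu) (inj₁ pv) → proper u v pu pv }) , λ _ _ → refl
    partial (x ∷ l) with partial l | true⊎false (P x)
    ... | c , pr , ag | inj₁ px = c , (λ u v du dv → pr u v (old u du) (old v dv)) , ag
      where
      old : ∀ u → Done (x ∷ l) u → Done l u
      old u (inj₁ p)            = inj₁ p
      old u (inj₂ (here refl))  = inj₁ px
      old u (inj₂ (there m))    = inj₂ m
    ... | c , pr , ag | inj₂ ¬px = c′ , pr′ , ag′
      where
      γ  = proj₁ (free x ¬px c ag)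
      γ∉ = proj₂ (free x ¬px c ag)
      c′ : Fin n → Fin k
      c′ u = if does (u ≟ x) then γ else c u
      old : ∀ {u} → u ≢ x → Done (x ∷ l) u → Done l u
      old ne (inj₁ p)           = inj₁ p
      old ne (inj₂ (here e))    = ⊥-elim (ne e)
      old ne (inj₂ (there m))   = inj₂ m
      pr′ : ∀ u v → Done (x ∷ l) u → Done (x ∷ l) v → Adj G u v → c′ u ≢ c′ v
      pr′ u v du dv a e with u ≟ x | v ≟ x
      ... | yes refl | yes refl = true≢false a (irrefl G u)
      ... | yes refl | no _     = γ∉ v a (≡.sym e)
      ... | no _     | yes refl = γ∉ u (trans (sym G v u) a) e
      ... | no ¬u    | no ¬v    = pr u v (old ¬u du) (old ¬v dv) a e
      ag′ : ∀ u → P u ≡ true → c′ u ≡ c₀ u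
      ag′ u pu with u ≟ x
      ... | yes refl = ⊥-elim (true≢false pu ¬px)
      ... | no _     = ag u pu

  extend : Σ (Fin n → Fin k) λ c →
    (∀ u v → Adj G u v → c u ≢ c v) × (∀ u → P u ≡ true → c u ≡ c₀ u)
  extend with partial (allFin n)
  ... | c , pr , ag = c , (λ u v → pr u v (inj₂ (∈-allFin u)) (inj₂ (∈-allFin v))) , ag

greedy : ∀ {k} (G : Graph n) → (∀ (c : Fin n → Fin (suc k)) v → Unseen G c v) → Colorable G (suc k)
greedy G free with extend G (λ _ → zero) (λ _ → false) (λ _ _ ()) (λ v _ c _ → free c v)
... | c , pr , _ = c , pr

CliqueBound : Graph n → ℕ → Set
CliqueBound {n} G w = ∀ {k} (f : Fin k → Fin n) → (∀ i j → i ≢ j → Adj G (f i) (f j)) → k ≤ w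

cliqueBound : {G : Graph n} {w : ℕ} → (∀ k → HasClique G k → k ≤ w) → CliqueBound G w
cliqueBound {G = G} h f a = h _ (f , inj , a)
  where
  inj : Injective _≡_ _≡_ f
  inj {i} {j} e with i ≟ j
  ... | yes p = p
  ... | no ¬p = ⊥-elim (true≢false (subst (Adj G (f i)) (≡.sym e) (a i j ¬p)) (irrefl G (f i)))

infixr 5 _◂_
_◂_ : ∀ {k} → Fin n → (Fin k → Fin n) → Fin (suc k) → Fin n
(v ◂ f) zero    = v
(v ◂ f) (suc i) = f i

◂-clique : ∀ (G : Graph n) {k} {v} {f : Fin k → Fin n} → (∀ i → Adj G v (f i)) →
  (∀ i j → i ≢ j → Adj G (f i) (f j)) → ∀ i j → i ≢ j → Adj G ((v ◂ f) i) ((v ◂ f) j)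
◂-clique G vf ff zero    zero    ne = ⊥-elim (ne refl)
◂-clique G vf ff zero    (suc j) ne = vf j
◂-clique G {v = v} {f} vf ff (suc i) zero ne = trans (sym G (f i) v) (vf i)
◂-clique G vf ff (suc i) (suc j) ne = ff i j (ne ∘ cong suc)

-- If `α` is not a value of `h`, index zero is dropped all the same, so each step costs exactly one
-- index and the colours to be avoided may coincide.
avoid : ∀ {k m} (h : Fin (suc m) → Fin k) → Injective _≡_ _≡_ h → (α : Fin k) →
  Σ (Fin m → Fin (suc m)) λ ι → Injective _≡_ _≡_ ι × (∀ i → h (ι i) ≢ α)
avoid h inj α with any? (λ i → h i ≟ α)
... | yes (i , e) = punchIn i , (λ {a} {b} → punchIn-injective i a b) ,
                    λ j e′ → punchInᵢ≢i i j (inj (trans e′ (≡.sym e)))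
... | no ¬e       = suc , (λ { refl → refl }) , λ j e → ¬e (suc j , e)

Among : ∀ {A : Set} → A → A → A → A → Set
Among α β δ x = x ≡ α ⊎ x ≡ β ⊎ x ≡ δ

-- Three colours may be lost to arbitrary neighbours; the remaining ones would have to occur on a clique.
unseen : ∀ {p} (G : Graph n) → CliqueBound G (3 + p) → (c : Fin n → Fin (6 + p)) (v : Fin n) (α β δ : Fin (6 + p)) →
  (∀ u u′ → Adj G v u → Adj G v u′ → u ≢ u′ → ¬ Among α β δ (c u) → ¬ Among α β δ (c u′) → Adj G u u′) →
  Unseen G c v
unseen G bound c v α β δ cl with unseen⊎rainbow G c v
... | inj₁ r = r
... | inj₂ (g , gp)
  with avoid id id α
... | ι₁ , inj₁′ , ≢α
  with avoid ι₁ inj₁′ β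
... | ι₂ , inj₂′ , ≢β
  with avoid (ι₁ ∘ ι₂) (inj₂′ ∘ inj₁′) δ
... | ι₃ , inj₃′ , ≢δ = ⊥-elim (1+n≰n (bound (v ◂ g ∘ ι) (◂-clique G (λ i → proj₁ (gp (ι i))) clique)))
  where
  ι = ι₁ ∘ ι₂ ∘ ι₃
  outside : ∀ i → ¬ Among α β δ (c (g (ι i)))
  outside i rewrite proj₂ (gp (ι i)) = [ ≢α (ι₂ (ι₃ i)) , [ ≢β (ι₃ i) , ≢δ i ] ]
  clique : ∀ i j → i ≢ j → Adj G (g (ι i)) (g (ι j))
  clique i j ne = cl _ _ (proj₁ (gp (ι i))) (proj₁ (gp (ι j)))
    (λ e → ne (inj₃′ (inj₂′ (inj₁′ (trans (≡.sym (proj₂ (gp (ι i)))) (trans (cong c e) (proj₂ (gp (ι j)))))))))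
    (outside i) (outside j)

two-colour : (G : Graph n) → (∀ v a b → Adj G v a → Adj G v b → a ≢ b → ⊥) → Colorable G 2
two-colour G deg = greedy G λ c v → case unseen⊎rainbow G c v of λ where
  (inj₁ r) → r
  (inj₂ (g , gp)) → ⊥-elim (deg v (g 0F) (g 1F) (proj₁ (gp 0F)) (proj₁ (gp 1F))
    λ e → case trans (≡.sym (proj₂ (gp 0F))) (trans (cong c e) (proj₂ (gp 1F))) of λ ())

-- Paths, components and parity

Adj-sym : (G : Graph n) → ∀ {u v} → Adj G u v → Adj G v u
Adj-sym G {u} {v} a = trans (sym G v u) a

module _ (G : Graph n) where

  data Walk (S : Fin n → Bool) : ℕ → Fin n → Fin n → Set where
    stop : ∀ {u} → S u ≡ true → Walk S 0 u u
    go   : ∀ {k u w v} → S u ≡ true → Adj G u w → Walk S k w v → Walk S (suc k) u v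

module _ {G : Graph n} {S : Fin n → Bool} where

  path-start : ∀ {u v} → PathIn G S u v → S u ≡ true
  path-start (here s)     = s
  path-start (step s _ _) = s

  path-end : ∀ {u v} → PathIn G S u v → S v ≡ true
  path-end (here s)     = s
  path-end (step _ _ p) = path-end p

  path-trans : ∀ {u v w} → PathIn G S u v → PathIn G S v w → PathIn G S u w
  path-trans (here _)     q = q
  path-trans (step s a p) q = step s a (path-trans p q)

  path-snoc : ∀ {u v w} → PathIn G S u v → Adj G v w → S w ≡ true → PathIn G S u w
  path-snoc p a s = path-trans p (step (path-end p) a (here s))

  path-sym : ∀ {u v} → PathIn G S u v → PathIn G S v u
  path-sym (here s)     = here s
  path-sym (step s a p) = path-snoc (path-sym p) (Adj-sym G a) s

  path-induction : (Q : Fin n → Set) → (∀ {u v} → S u ≡ true → S v ≡ true → Adj G u v → Q u → Q v) →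
    ∀ {u v} → PathIn G S u v → Q u → Q v
  path-induction Q next (here _)     q = q
  path-induction Q next (step s a p) q = path-induction Q next p (next s (path-start p) a q)

  path⇒walk : ∀ {u v} → PathIn G S u v → ∃ λ k → Walk G S k u v
  path⇒walk (here s)     = 0 , stop s
  path⇒walk (step s a p) with path⇒walk p
  ... | k , w = suc k , go s a w

  walk-snoc : ∀ {k u v w} → Walk G S k u v → Adj G v w → S w ≡ true → Walk G S (suc k) u w
  walk-snoc (stop s)   b t = go s b (stop t)
  walk-snoc (go s a p) b t = go s a (walk-snoc p b t)

  walk-sym : ∀ {k u v} → Walk G S k u v → Walk G S k v u
  walk-sym (stop s)   = stop s
  walk-sym (go s a p) = walk-snoc (walk-sym p) (Adj-sym G a) s

  walk-++ : ∀ {k l u v w} → Walk G S k u v → Walk G S l v w → Walk G S (k + l) u w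
  walk-++ (stop _)   q = q
  walk-++ (go s a p) q = go s a (walk-++ p q)

module _ (G : Graph n) (S : Fin n → Bool) (path? : ∀ u v → Dec (PathIn G S u v)) where

  module _ (D : Fin n → Fin n → A) where

    private
      Agrees : (Fin n → A) → Fin n → Set
      Agrees E v = ∃ λ w → PathIn G S w v × (∀ u → PathIn G S w u → E u ≡ D w u)

      patch-list : ∀ l → Σ (Fin n → A) λ E → ∀ v x → x ∈ l → PathIn G S x v → Agrees E v
      patch-list []      = (λ u → D u u) , λ _ _ ()
      patch-list (y ∷ l) with patch-list l
      ... | E , h = E′ , h′
        where
        E′ : Fin n → A
        E′ u = if does (path? y u) then D y u else E u
        E′-in : ∀ u → PathIn G S y u → E′ u ≡ D y u
        E′-in u p rewrite dec-true (path? y u) p = refl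
        E′-out : ∀ u → ¬ PathIn G S y u → E′ u ≡ E u
        E′-out u p rewrite dec-false (path? y u) p = refl
        h′ : ∀ v x → x ∈ y ∷ l → PathIn G S x v → Agrees E′ v
        h′ v x m p with path? y v
        h′ v x m p           | yes q = y , q , E′-in
        h′ v x (here refl) p | no ¬q = ⊥-elim (¬q p)
        h′ v x (there m) p   | no ¬q with h v x m p
        ... | w , pw , ag = w , pw , λ u pu →
          trans (E′-out u λ q → ¬q (path-trans q (path-trans (path-sym pu) pw))) (ag u pu)

    -- The choices `D w` and `D w′` for two vertices of one component may differ, so each component
    -- must commit to a single representative: the earliest vertex of the list that reaches it.
    patch : Σ (Fin n → A) λ E → ∀ v → S v ≡ true →
      ∃ λ w → PathIn G S w v × (∀ u → PathIn G S w u → E u ≡ D w u)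
    patch with patch-list (allFin n)
    ... | E , h = E , λ v s → h v v (∈-allFin v) (here s)

odd : ℕ → Bool
odd zero          = false
odd (suc zero)    = true
odd (suc (suc k)) = odd k

odd-suc : ∀ k → odd (suc k) ≡ not (odd k)
odd-suc zero          = refl
odd-suc (suc zero)    = refl
odd-suc (suc (suc k)) = odd-suc k

odd-+ : ∀ k l → odd k ≡ false → odd (k + l) ≡ odd l
odd-+ zero          l _ = refl
odd-+ (suc (suc k)) l e = odd-+ k l e

-- Forbidden induced subgraphs as adjacency patterns

P₆-rows : ∀ i j → (∀ k → P6-adj i k ≡ P6-adj j k) → i ≡ j
P₆-rows = toWitness {a? = all? λ i → all? λ j → (all? λ k → P6-adj i k Bool.≟ P6-adj j k) →-dec (i ≟ j)} tt

-- No distinctness premises: `P6` has no two vertices with equal neighbourhoods (`P₆-rows`), so the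
-- pattern alone forces injectivity. In the diamond the two non-adjacent vertices are twins, whence
-- `c ≢ d` in `NoDiamond`.
NoP₆ : Graph n → Set
NoP₆ {n} G = ∀ {a b c d e f : Fin n} →
  Adj G a b → Adj G b c → Adj G c d → Adj G d e → Adj G e f →
  adj G a c ≡ false → adj G a d ≡ false → adj G a e ≡ false → adj G a f ≡ false →
  adj G b d ≡ false → adj G b e ≡ false → adj G b f ≡ false →
  adj G c e ≡ false → adj G c f ≡ false → adj G d f ≡ false → ⊥

noP₆ : (G : Graph n) → ¬ ContainsInduced G P6 → NoP₆ G
noP₆ {n} G free {a} {b} {c} {d} {e} {f} ab bc cd de ef ac ad ae af bd be bf ce cf df =
  free (v , inj , same)
  where
  v : Fin 6 → Fin n
  v 0F = a ; v 1F = b ; v 2F = c ; v 3F = d ; v 4F = e ; v 5F = f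
  upper : ∀ i j → P6-adj i j ≡ adj G (v i) (v j) → P6-adj j i ≡ adj G (v j) (v i)
  upper i j p = trans (P6-sym j i) (trans p (sym G (v i) (v j)))
  same : ∀ i j → P6-adj i j ≡ adj G (v i) (v j)
  same 0F 0F = ≡.sym (irrefl G a)
  same 1F 1F = ≡.sym (irrefl G b)
  same 2F 2F = ≡.sym (irrefl G c)
  same 3F 3F = ≡.sym (irrefl G d)
  same 4F 4F = ≡.sym (irrefl G e)
  same 5F 5F = ≡.sym (irrefl G f)
  same 0F 1F = ≡.sym ab
  same 0F 2F = ≡.sym ac
  same 0F 3F = ≡.sym ad
  same 0F 4F = ≡.sym ae
  same 0F 5F = ≡.sym af
  same 1F 2F = ≡.sym bc
  same 1F 3F = ≡.sym bd
  same 1F 4F = ≡.sym be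
  same 1F 5F = ≡.sym bf
  same 2F 3F = ≡.sym cd
  same 2F 4F = ≡.sym ce
  same 2F 5F = ≡.sym cf
  same 3F 4F = ≡.sym de
  same 3F 5F = ≡.sym df
  same 4F 5F = ≡.sym ef
  same 1F 0F = upper 0F 1F (≡.sym ab)
  same 2F 0F = upper 0F 2F (≡.sym ac)
  same 3F 0F = upper 0F 3F (≡.sym ad)
  same 4F 0F = upper 0F 4F (≡.sym ae)
  same 5F 0F = upper 0F 5F (≡.sym af)
  same 2F 1F = upper 1F 2F (≡.sym bc)
  same 3F 1F = upper 1F 3F (≡.sym bd)
  same 4F 1F = upper 1F 4F (≡.sym be)
  same 5F 1F = upper 1F 5F (≡.sym bf)
  same 3F 2F = upper 2F 3F (≡.sym cd)
  same 4F 2F = upper 2F 4F (≡.sym ce)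
  same 5F 2F = upper 2F 5F (≡.sym cf)
  same 4F 3F = upper 3F 4F (≡.sym de)
  same 5F 3F = upper 3F 5F (≡.sym df)
  same 5F 4F = upper 4F 5F (≡.sym ef)
  inj : Injective _≡_ _≡_ v
  inj {i} {j} q = P₆-rows i j λ k →
    trans (same i k) (trans (cong (λ x → adj G x (v k)) q) (≡.sym (same j k)))

-- The positive form used throughout: the common neighbours of an edge `ab` form a clique.
NoDiamond : Graph n → Set
NoDiamond {n} G = ∀ {a b c d : Fin n} →
  Adj G a b → Adj G a c → Adj G b c → Adj G a d → Adj G b d → c ≢ d → Adj G c d

noDiamond : (G : Graph n) → ¬ ContainsInduced G diamond → NoDiamond G
noDiamond {n} G free {a} {b} {c} {d} ab ac bc ad bd c≢d with true⊎false (adj G c d)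
... | inj₁ cd = cd
... | inj₂ cd = ⊥-elim (free (v , inj , same))
  where
  v : Fin 4 → Fin n
  v 0F = a ; v 1F = b ; v 2F = c ; v 3F = d
  lower : ∀ i j → diamond-adj i j ≡ adj G (v i) (v j) → diamond-adj j i ≡ adj G (v j) (v i)
  lower i j p = trans (diamond-sym j i) (trans p (sym G (v i) (v j)))
  same : ∀ i j → diamond-adj i j ≡ adj G (v i) (v j)
  same 0F 0F = ≡.sym (irrefl G a)
  same 1F 1F = ≡.sym (irrefl G b)
  same 2F 2F = ≡.sym (irrefl G c)
  same 3F 3F = ≡.sym (irrefl G d)
  same 0F 1F = ≡.sym ab
  same 0F 2F = ≡.sym ac
  same 0F 3F = ≡.sym ad
  same 1F 2F = ≡.sym bc
  same 1F 3F = ≡.sym bd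
  same 2F 3F = ≡.sym cd
  same 1F 0F = lower 0F 1F (≡.sym ab)
  same 2F 0F = lower 0F 2F (≡.sym ac)
  same 3F 0F = lower 0F 3F (≡.sym ad)
  same 2F 1F = lower 1F 2F (≡.sym bc)
  same 3F 1F = lower 1F 3F (≡.sym bd)
  same 3F 2F = lower 2F 3F (≡.sym cd)
  rows : ∀ i j → (∀ k → diamond-adj i k ≡ diamond-adj j k) → i ≡ j ⊎ v i ≢ v j
  rows 0F 0F h = inj₁ refl
  rows 1F 1F h = inj₁ refl
  rows 2F 2F h = inj₁ refl
  rows 3F 3F h = inj₁ refl
  rows 2F 3F h = inj₂ c≢d
  rows 3F 2F h = inj₂ (c≢d ∘ ≡.sym)
  rows 0F 1F h with () ← h 0F
  rows 0F 2F h with () ← h 0F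
  rows 0F 3F h with () ← h 0F
  rows 1F 0F h with () ← h 0F
  rows 1F 2F h with () ← h 1F
  rows 1F 3F h with () ← h 1F
  rows 2F 0F h with () ← h 0F
  rows 2F 1F h with () ← h 1F
  rows 3F 0F h with () ← h 0F
  rows 3F 1F h with () ← h 1F
  inj : Injective _≡_ _≡_ v
  inj {i} {j} q with rows i j (λ k → trans (same i k) (trans (cong (λ x → adj G x (v k)) q) (≡.sym (same j k))))
  ... | inj₁ e = e
  ... | inj₂ e = ⊥-elim (e q)

-- Bipartiteness from the absence of odd cycles of length 3 and 5

module _ (G : Graph n) (p₆ : NoP₆ G) (H : Fin n → Bool)
  (noC₃ : ∀ {a b c} → H a ≡ true → H b ≡ true → H c ≡ true →
    Adj G a b → Adj G b c → Adj G a c → ⊥)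
  (noC₅ : ∀ {a b c d e} → H a ≡ true → H b ≡ true → H c ≡ true → H d ≡ true → H e ≡ true →
    Adj G a b → Adj G b c → Adj G c d → Adj G d e → Adj G e a → ⊥) where

  -- A chord of a shortest odd closed walk of length at least 7 would yield a shorter one,
  -- so its first six vertices induce a P₆.
  no-odd-walk : ∀ N k → k ≤ N → odd k ≡ true → ∀ {v} → Walk G H k v v → ⊥
  no-odd-walk N .1 _ _ (go {u = v} _ a (stop _)) = true≢false a (irrefl G v)
  no-odd-walk N .3 _ _ (go h₀ a (go h₁ b (go h₂ c (stop _)))) = noC₃ h₀ h₁ h₂ a b (Adj-sym G c)
  no-odd-walk N .5 _ _ (go h₀ a (go h₁ b (go h₂ c (go h₃ d (go h₄ e (stop _)))))) =
    noC₅ h₀ h₁ h₂ h₃ h₄ a b c d e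
  no-odd-walk (suc (suc N)) (suc (suc (suc (suc (suc (suc k)))))) (s≤s (s≤s le)) o {v₀}
    (go h₀ a (go {u = v₁} h₁ b (go {u = v₂} h₂ c (go {u = v₃} h₃ d (go {u = v₄} h₄ e r@(go {u = v₅} h₅ _ _)))))) =
    p₆ a b c d e (tri h₀ h₁ h₂ a b)
      (chord λ q → shorter (go h₀ q (go h₃ d (go h₄ e r))))
      (chord λ q → five (go h₀ a (go h₁ b (go h₂ c (go h₃ d (go h₄ (Adj-sym G q) (stop h₀)))))))
      (chord λ q → shorter′ (go h₀ q r))
      (tri h₁ h₂ h₃ b c)
      (chord λ q → shorter (go h₀ a (go h₁ q (go h₄ e r))))
      (chord λ q → five (go h₁ b (go h₂ c (go h₃ d (go h₄ e (go h₅ (Adj-sym G q) (stop h₁)))))))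
      (tri h₂ h₃ h₄ c d)
      (chord λ q → shorter (go h₀ a (go h₁ b (go h₂ q r))))
      (tri h₃ h₄ h₅ d e)
    where
    chord : ∀ {u v} → ¬ Adj G u v → adj G u v ≡ false
    chord {u} {v} ¬a with true⊎false (adj G u v)
    ... | inj₁ q = ⊥-elim (¬a q)
    ... | inj₂ q = q
    tri : ∀ {u v w} → H u ≡ true → H v ≡ true → H w ≡ true → Adj G u v → Adj G v w → adj G u w ≡ false
    tri hu hv hw p q = chord (noC₃ hu hv hw p q)
    shorter : Walk G H (4 + k) v₀ v₀ → ⊥
    shorter w = no-odd-walk N (4 + k) le o w
    shorter′ : Walk G H (2 + k) v₀ v₀ → ⊥
    shorter′ w = no-odd-walk N (2 + k) (≤-trans (m≤n⇒m≤1+n (m≤n⇒m≤1+n ≤-refl)) le) o w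
    five : ∀ {v} → Walk G H 5 v v → ⊥
    five (go h₀ a (go h₁ b (go h₂ c (go h₃ d (go h₄ e (stop _)))))) = noC₅ h₀ h₁ h₂ h₃ h₄ a b c d e

  -- A vertex is coloured by whether an even walk reaches it from the representative of its
  -- component. For adjacent `u` and `v` two even walks would close to an odd one; if neither
  -- exists, a path to `u` is odd and its extension to `v` is even.
  bipartite : ¬ ¬ (Σ (Fin n → Bool) λ c → ∀ u v → H u ≡ true → H v ≡ true → Adj G u v → c u ≢ c v)
  bipartite =
    ¬¬-∀Fin (λ u → dec-pred (PathIn G H u)) >>= λ path? →
    ¬¬-∀Fin (λ w → dec-pred (Even w)) >>= λ even? →
    let E , h = patch G H path? (λ w v → does (even? w v)) in
    return (E , λ u v hu hv a e → let w , pw , ag = h u hu in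
      separated even? pw a hv
        (trans (≡.sym (ag u pw)) (trans e (ag v (path-snoc pw a hv)))))
    where
    Even : Fin n → Fin n → Set
    Even w v = ∃ λ k → odd k ≡ false × Walk G H k w v
    separated : (even? : ∀ w v → Dec (Even w v)) → ∀ {w u v} → PathIn G H w u → Adj G u v → H v ≡ true →
      does (even? w u) ≡ does (even? w v) → ⊥
    separated even? {w} {u} {v} p a hv eq with even? w u | even? w v
    separated even? p a hv () | yes _ | no _
    separated even? p a hv () | no _ | yes _
    ... | yes (k , ek , wk) | yes (l , el , wl) =
      no-odd-walk (k + suc l) (k + suc l) ≤-refl
        (trans (odd-+ k (suc l) ek) (trans (odd-suc l) (cong not el)))
        (walk-++ wk (go (path-end p) a (walk-sym wl)))
    ... | no ¬u | no ¬v with path⇒walk p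
    ... | k , wk with true⊎false (odd k)
    ... | inj₂ ek = ¬u (k , ek , wk)
    ... | inj₁ ok = ¬v (suc k , trans (odd-suc k) (cong not ok) , walk-snoc wk a hv)

module Base {n : ℕ} (G : Graph n) where

  infix 4 _~_ _≁_
  _~_ _≁_ : Fin n → Fin n → Set
  u ~ v = Adj G u v
  u ≁ v = adj G u v ≡ false

  ~sym : ∀ {u v} → u ~ v → v ~ u
  ~sym = Adj-sym G

  ≁sym : ∀ {u v} → u ≁ v → v ≁ u
  ≁sym {u} {v} p = trans (sym G v u) p

  split : ∀ u v → (u ~ v → A) → (u ≁ v → A) → A
  split u v f g = [ f , g ] (true⊎false (adj G u v))

  ≁-intro : ∀ {u v} → ¬ u ~ v → u ≁ v
  ≁-intro {u} {v} h = split u v (λ p → ⊥-elim (h p)) id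

  ~⇒≢ : ∀ {u v} → u ~ v → u ≢ v
  ~⇒≢ {u} p refl = true≢false p (irrefl G u)

  separated : ∀ {u v w} → u ~ w → v ≁ w → u ≢ v
  separated p q refl = true≢false p q

-- Choosing an edge with small neighbourhoods

module EdgeChoice {n : ℕ} (G : Graph n) (p₆ : NoP₆ G) (◇ : NoDiamond G)
  (connected : Connected G) (noCut : ¬ HasCliqueCutset G)
  {ω : ℕ} (bound : CliqueBound G ω)
  (k : Fin ω → Fin n) (kk : ∀ i j → i ≢ j → Adj G (k i) (k j)) where

  open Base G

  Out : Fin n → Set
  Out v = ∀ i → v ≢ k i

  -- Any other `k l` shares with `v` the edge between `k i` and `k j`, so diamond-freeness makes `v`
  -- adjacent to the whole clique, which is then not maximum.
  one-neighbour : ∀ {v i j} → Out v → v ~ k i → v ~ k j → i ≢ j → ⊥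
  one-neighbour {v} {i} {j} out vi vj ne = 1+n≰n (bound (v ◂ k) (◂-clique G all kk))
    where
    all : ∀ l → v ~ k l
    all l with l ≟ i | l ≟ j
    ... | yes refl | _        = vi
    ... | no _     | yes refl = vj
    ... | no li    | no lj    =
      ◇ (kk i j ne) (~sym vi) (~sym vj) (kk i l (li ∘ ≡.sym)) (kk j l (lj ∘ ≡.sym)) (out l)

  record PrivateTriangle (i : Fin ω) (y : Fin n) : Set where
    constructor triangle
    field
      {y′ y″} : Fin n
      yy′ : y ~ y′
      yy″ : y ~ y″
      y′y″ : y′ ~ y″
      yk : y ~ k i
      y′k : y′ ~ k i
      y″k : y″ ~ k i
      outy : Out y
      outy′ : Out y′
      outy″ : Out y″

  rotate : ∀ {i y} (t : PrivateTriangle i y) → PrivateTriangle i (PrivateTriangle.y′ t)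
  rotate (triangle a b c p q r o o′ o″) = triangle (~sym a) c b q p r o′ o o″

  Escape : Fin ω → Set
  Escape i = ∃ λ y → ∃ λ w → ∃ λ j → PrivateTriangle i y × Out w × j ≢ i × y ~ w × w ~ k j

  module _ {i j l : Fin ω} (i≢j : i ≢ j) (l≢i : l ≢ i) (l≢j : l ≢ j) where

    private
      S : Fin n → Bool
      S v = not (does (v ≟ k i))

      S⇒≢ : ∀ {v} → S v ≡ true → v ≢ k i
      S⇒≢ {v} s = does-no (v ≟ k i) (not-true s)

      ≢⇒S : ∀ {v} → v ≢ k i → S v ≡ true
      ≢⇒S {v} ne = not-false (dec-false (v ≟ k i) ne)

    -- A walk from a private triangle to k j either leaves it through a neighbour of another k,
    -- or can be shortened, or contains an induced P₆.
    escape-walk : ∀ N m → m ≤ N → ∀ {y} → PrivateTriangle i y → Walk G S m y (k j) → Escape i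
    escape-walk N .0 _ t (stop _) = ⊥-elim (PrivateTriangle.outy t j refl)
    escape-walk N .1 _ t (go _ a (stop _)) = ⊥-elim (one-neighbour outy yk a i≢j)
      where open PrivateTriangle t
    escape-walk (suc N) (suc (suc m)) (s≤s le) {y} t (go s a r@(go {u = p₁} s₁ b r₁))
      with any? (λ q → p₁ ≟ k q)
    ... | yes (q , refl) =
      ⊥-elim (one-neighbour (PrivateTriangle.outy t) (PrivateTriangle.yk t) a λ { refl → S⇒≢ s₁ refl })
    ... | no ¬p₁ = split p₁ (k i)
        (λ p₁k → escape-walk N (suc m) le (next p₁k) r)
        (λ p₁≁k → leave p₁≁k r₁ le b)
      where
      open PrivateTriangle t
      out₁ : Out p₁
      out₁ q e = ¬p₁ (q , e)

      next : p₁ ~ k i → PrivateTriangle i p₁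
      next p₁k with p₁ ≟ y′
      ... | yes refl = triangle (~sym yy′) y′y″ yy″ y′k yk y″k outy′ outy outy″
      ... | no ne    = triangle (~sym a) (◇ yk a (~sym p₁k) yy′ (~sym y′k) ne) yy′ p₁k yk y′k out₁ outy outy′

      exit : ∀ q → q ≢ i → p₁ ~ k q → Escape i
      exit q ne e = y , p₁ , q , t , out₁ , ne , a , e

      leave : ∀ {m p₂} → p₁ ≁ k i → Walk G S m p₂ (k j) → suc m ≤ N → p₁ ~ p₂ → Escape i
      leave p₁≁k (stop _) le b = exit j (i≢j ∘ ≡.sym) b
      leave {suc m} {p₂} p₁≁k r₁@(go s₂ c r₂) le b =
        split p₁ (k j) (exit j (i≢j ∘ ≡.sym)) λ p₁≁kj →
        split p₁ (k l) (exit l l≢i) λ p₁≁kl →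
        split y p₂ (λ q → escape-walk N (2 + m) le t (go s q r₁)) λ y≁p₂ →
        split y′ p₂ (λ q → escape-walk N (2 + m) le (rotate t) (go (≢⇒S (outy′ i)) q r₁)) λ y′≁p₂ →
        far p₁≁kj p₁≁kl y≁p₂ y′≁p₂ r₂ le c
        where
        y′≁p₁ : y′ ≁ p₁
        y′≁p₁ = ≁-intro λ q → true≢false (◇ yy′ a q yk y′k (out₁ i)) p₁≁k
        y≁k : ∀ q → q ≢ i → y ≁ k q
        y≁k q ne = ≁-intro λ e → one-neighbour outy e yk ne
        y′≁k : ∀ q → q ≢ i → y′ ≁ k q
        y′≁k q ne = ≁-intro λ e → one-neighbour outy′ e y′k ne

        far : ∀ {m p₃} → p₁ ≁ k j → p₁ ≁ k l → y ≁ p₂ → y′ ≁ p₂ → Walk G S m p₃ (k j) →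
          2 + m ≤ N → p₂ ~ p₃ → Escape i
        far p₁≁kj p₁≁kl y≁p₂ y′≁p₂ (stop _) le c with any? (λ q → p₂ ≟ k q)
        ... | yes (q , refl) = exit q (λ { refl → S⇒≢ s₂ refl }) b
        -- This walk is too short for six vertices; the third clique vertex `k l` supplies the last
        -- one.
        ... | no ¬p₂ = ⊥-elim (p₆ (~sym yy′) a b c (kk j l (l≢j ∘ ≡.sym))
          y′≁p₁ y′≁p₂ (y′≁k j (i≢j ∘ ≡.sym)) (y′≁k l l≢i)
          y≁p₂ (y≁k j (i≢j ∘ ≡.sym)) (y≁k l l≢i)
          p₁≁kj p₁≁kl
          (≁-intro λ e → one-neighbour (λ q e′ → ¬p₂ (q , e′)) e c l≢j))
        far {suc m} {p₃} p₁≁kj p₁≁kl y≁p₂ y′≁p₂ r₂@(go {w = p₄} s₃ d r₃) le c =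
          split y p₃ (λ q → escape-walk N (2 + m) le₂ t (go s q r₂)) λ y≁p₃ →
          split y′ p₃ (λ q → escape-walk N (2 + m) le₂ (rotate t) (go S′ q r₂)) λ y′≁p₃ →
          split p₁ p₃ (λ q → escape-walk N (3 + m) le t (go s a (go s₁ q r₂))) λ p₁≁p₃ →
          split y p₄ (λ q → escape-walk N (1 + m) le₁ t (go s q r₃)) λ y≁p₄ →
          split y′ p₄ (λ q → escape-walk N (1 + m) le₁ (rotate t) (go S′ q r₃)) λ y′≁p₄ →
          split p₁ p₄ (λ q → escape-walk N (2 + m) le₂ t (go s a (go s₁ q r₃))) λ p₁≁p₄ →
          split p₂ p₄ (λ q → escape-walk N (3 + m) le t (go s a (go s₁ b (go s₂ q r₃)))) λ p₂≁p₄ →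
          ⊥-elim (p₆ (~sym yy′) a b c d y′≁p₁ y′≁p₂ y′≁p₃ y′≁p₄ y≁p₂ y≁p₃ y≁p₄ p₁≁p₃ p₁≁p₄ p₂≁p₄)
          where
          S′ = ≢⇒S (outy′ i)
          le₂ : 2 + m ≤ N
          le₂ = ≤-trans (m≤n⇒m≤1+n ≤-refl) le
          le₁ : 1 + m ≤ N
          le₁ = ≤-trans (m≤n⇒m≤1+n ≤-refl) le₂

    -- Otherwise the single vertex `k i` would be a clique cutset separating the triangle from
    -- `k j`.
    escape : ∀ {y} → PrivateTriangle i y → ¬ ¬ Escape i
    escape {y} t none = noCut (Kᵢ , clique , y , k j , dec-false (y ≟ k i) (outy i) ,
      dec-false (k j ≟ k i) (~⇒≢ (kk j i (i≢j ∘ ≡.sym))) , connected y (k j) , λ p →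
      let m , w = path⇒walk p in none (escape-walk m m ≤-refl t w))
      where
      open PrivateTriangle t
      Kᵢ : Fin n → Bool
      Kᵢ v = does (v ≟ k i)
      clique : IsCliqueSet G Kᵢ
      clique u v eu ev ne = ⊥-elim (ne (trans (does-yes (u ≟ k i) eu) (≡.sym (does-yes (v ≟ k i) ev))))

  -- Let `u` belong to a private triangle at `k l`. It cannot see both `y′` and `y″`, or it would
  -- see `k i`; let `z` be one that it misses. Unless `u` sees `y` or `w`, the path `z`, `y`, `w`,
  -- `k j`, `k l`, `u` is an induced P₆. So two of the three triangle vertices see the same one of
  -- `y` and `w`, which is then adjacent to `k l` by diamond-freeness, a second neighbour in the
  -- clique.
  triangle-free-beyond : ∀ {i} → Escape i → ∃ λ j → ∀ l → l ≢ i → l ≢ j → ∀ {u} → ¬ PrivateTriangle l u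
  triangle-free-beyond {i} (y , w , j , t , outw , j≢i , yw , wk) = j , beyond
    where
    open PrivateTriangle t
    beyond : ∀ l → l ≢ i → l ≢ j → ∀ {u} → ¬ PrivateTriangle l u
    beyond l l≢i l≢j {u₁} (triangle {u₂} {u₃} u₁₂ u₁₃ u₂₃ u₁k u₂k u₃k o₁ o₂ o₃) =
      two (near u₁k o₁) (near u₂k o₂) (near u₃k o₃)
      where
      w≁kᵢ : w ≁ k i
      w≁kᵢ = ≁-intro λ e → one-neighbour outw e wk (j≢i ∘ ≡.sym)
      w≁ : ∀ {z} → y ~ z → z ~ k i → z ≁ w
      w≁ yz zk = ≁-intro λ e → true≢false (◇ yz yw e yk zk (outw i)) w≁kᵢ
      out≁ : ∀ {v a b} → Out v → v ~ k a → b ≢ a → v ≁ k b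
      out≁ o va ne = ≁-intro λ e → one-neighbour o e va ne
      path : ∀ {z u} → y ~ z → z ~ k i → Out z → u ~ k l → Out u → z ≁ u → y ≁ u → u ~ w
      path {z} {u} yz zk oz uk ou zu yu = split u w id λ uw →
        ⊥-elim (p₆ (~sym yz) yw wk (kk j l (l≢j ∘ ≡.sym)) (~sym uk)
          (w≁ yz zk) (out≁ oz zk j≢i) (out≁ oz zk l≢i) zu
          (out≁ outy yk j≢i) (out≁ outy yk l≢i) yu
          (out≁ outw wk l≢j) (≁sym uw) (≁sym (out≁ ou uk (l≢j ∘ ≡.sym))))
      near : ∀ {u} → u ~ k l → Out u → u ~ y ⊎ u ~ w
      near {u} uk ou = split u y inj₁ λ uy → split y′ u
        (λ y′u → inj₂ (path yy″ y″k outy″ uk ou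
          (≁-intro λ y″u → one-neighbour ou
            (◇ y′y″ y′u y″u y′k y″k (ou i)) uk (l≢i ∘ ≡.sym)) (≁sym uy)))
        (λ y′u → inj₂ (path yy′ y′k outy′ uk ou y′u (≁sym uy)))
      apart : ∀ {a b z m} → a ~ b → a ~ k l → b ~ k l → Out z → z ~ k m → l ≢ m → a ~ z → b ~ z → ⊥
      apart ab ak bk oz zk ne az bz = one-neighbour oz (◇ ab az bz ak bk (oz l)) zk ne
      two : u₁ ~ y ⊎ u₁ ~ w → u₂ ~ y ⊎ u₂ ~ w → u₃ ~ y ⊎ u₃ ~ w → ⊥
      two (inj₁ a) (inj₁ b) _        = apart u₁₂ u₁k u₂k outy yk l≢i a b
      two (inj₂ a) (inj₂ b) _        = apart u₁₂ u₁k u₂k outw wk l≢j a b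
      two (inj₁ a) (inj₂ b) (inj₁ c) = apart u₁₃ u₁k u₃k outy yk l≢i a c
      two (inj₁ a) (inj₂ b) (inj₂ c) = apart u₂₃ u₂k u₃k outw wk l≢j b c
      two (inj₂ a) (inj₁ b) (inj₁ c) = apart u₂₃ u₂k u₃k outy yk l≢i b c
      two (inj₂ a) (inj₁ b) (inj₂ c) = apart u₁₃ u₁k u₃k outw wk l≢j a c

Private : Graph n → Fin n → Fin n → Fin n → Set
Private G a b x = Adj G a x × adj G b x ≡ false × x ≢ b

Light : Graph n → Fin n → Fin n → Set
Light G a b = ∀ x y z → Private G a b x → Private G a b y → Private G a b z →
  Adj G x y → Adj G x z → Adj G y z → ⊥

LightEdge : Graph n → Fin n → Fin n → Set
LightEdge G a b = Adj G a b × Light G a b × Light G b a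

light-edge : (G : Graph n) → NoP₆ G → NoDiamond G → Connected G → ¬ HasCliqueCutset G →
  ∀ {p} → CliqueBound G (3 + p) → HasClique G (3 + p) → ¬ ¬ (∃ λ a → ∃ λ b → LightEdge G a b)
light-edge G p₆ ◇ conn noCut {zero} bound (k , _ , kk) = return (k 0F , k 1F , kk 0F 1F (λ ()) , light 0F , light 1F)
  where
  light : ∀ i {b} → Light G (k i) b
  light i x y z (ax , _) (ay , _) (az , _) xy xz yz =
    1+n≰n (bound (k i ◂ x ◂ y ◂ z ◂ λ ())
      (◂-clique G (λ { 0F → ax ; 1F → ay ; 2F → az })
      (◂-clique G (λ { 0F → xy ; 1F → xz })
      (◂-clique G (λ { 0F → yz })
      (◂-clique G (λ ()) λ ())))))
light-edge {n} G p₆ ◇ conn noCut {suc p} bound (k , _ , kk) =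
  -- Only a heavy index and the `j` of its escape can be heavy, so two light ones remain among `0F`
  -- to `3F`.
  em (Heavy 0F) >>= λ where
    (yes (_ , t)) → escape {0F} {1F} {2F} (λ ()) (λ ()) (λ ()) t >>= λ e →
      let j , free = triangle-free-beyond e in return (from₀ j free)
    (no ¬h₀) → em (Heavy 1F) >>= λ where
      (yes (_ , t)) → escape {1F} {0F} {2F} (λ ()) (λ ()) (λ ()) t >>= λ e →
        let j , free = triangle-free-beyond e in return (from₁ ¬h₀ j free)
      (no ¬h₁) → return (edge 0F 1F (λ ()) (λ t → ¬h₀ (_ , t)) (λ t → ¬h₁ (_ , t)))
  where
  open Base G
  open EdgeChoice G p₆ ◇ conn noCut bound k kk
  Heavy : Fin (4 + p) → Set
  Heavy i = ∃ (PrivateTriangle i)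
  light : ∀ i j → i ≢ j → (∀ {u} → ¬ PrivateTriangle i u) → Light G (k i) (k j)
  light i j i≢j none x y z (ix , jx , nx) (iy , jy , ny) (iz , jz , nz) xy xz yz =
    none (triangle xy xz yz (~sym ix) (~sym iy) (~sym iz) (out ix jx nx) (out iy jy ny) (out iz jz nz))
    where
    out : ∀ {x} → k i ~ x → k j ≁ x → x ≢ k j → Out x
    out ix jx nx l refl with l ≟ j
    ... | yes refl = nx refl
    ... | no ne    = true≢false (kk j l (ne ∘ ≡.sym)) jx
  edge : ∀ i j → i ≢ j → (∀ {u} → ¬ PrivateTriangle i u) → (∀ {u} → ¬ PrivateTriangle j u) →
    ∃ λ a → ∃ λ b → LightEdge G a b
  edge i j ne fi fj = k i , k j , kk i j ne , light i j ne fi , light j i (ne ∘ ≡.sym) fj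
  from₀ : ∀ j → (∀ l → l ≢ 0F → l ≢ j → ∀ {u} → ¬ PrivateTriangle l u) → ∃ λ a → ∃ λ b → LightEdge G a b
  from₀ j free with 1F ≟ j | 2F ≟ j
  ... | no n₁    | no n₂    = edge 1F 2F (λ ()) (free 1F (λ ()) n₁) (free 2F (λ ()) n₂)
  ... | yes refl | _        = edge 2F 3F (λ ()) (free 2F (λ ()) λ ()) (free 3F (λ ()) λ ())
  ... | no n₁    | yes refl = edge 1F 3F (λ ()) (free 1F (λ ()) n₁) (free 3F (λ ()) λ ())
  from₁ : ¬ Heavy 0F → ∀ j → (∀ l → l ≢ 1F → l ≢ j → ∀ {u} → ¬ PrivateTriangle l u) → ∃ λ a → ∃ λ b → LightEdge G a b
  from₁ ¬h₀ j free with 2F ≟ j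
  ... | no n₂    = edge 0F 2F (λ ()) (λ t → ¬h₀ (_ , t)) (free 2F (λ ()) n₂)
  ... | yes refl = edge 0F 3F (λ ()) (λ t → ¬h₀ (_ , t)) (free 3F (λ ()) λ ())

-- Components off the chosen edge

module OffEdge {n : ℕ} (G : Graph n) (p₆ : NoP₆ G) (◇ : NoDiamond G)
  (connected : Connected G) (noCut : ¬ HasCliqueCutset G)
  (k₁ k₂ : Fin n) (k₁k₂ : Adj G k₁ k₂) where

  open Base G

  κ : Bool → Fin n
  κ true  = k₁
  κ false = k₂

  κκ : ∀ s → κ s ~ κ (not s)
  κκ true  = k₁k₂
  κκ false = ~sym k₁k₂

  W : Fin n → Bool
  W v = not (adj G k₁ v) ∧ not (adj G k₂ v)

  W⇒≁ : ∀ {v} → W v ≡ true → ∀ s → κ s ≁ v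
  W⇒≁ {v} w true  = not-true (proj₁ (∧-split {not (adj G k₁ v)} w))
  W⇒≁ {v} w false = not-true (proj₂ (∧-split {not (adj G k₁ v)} w))

  Side : Bool → Fin n → Set
  Side s = Private G (κ s) (κ (not s))

  Common : Fin n → Set
  Common x = k₁ ~ x × k₂ ~ x

  W-excludes : ∀ {v} s → κ s ~ v → W v ≡ false
  W-excludes {v} s a with true⊎false (W v)
  ... | inj₁ w = ⊥-elim (true≢false a (W⇒≁ w s))
  ... | inj₂ w = w

  side⇒¬W : ∀ {s x} → Side s x → W x ≡ false
  side⇒¬W {s} (a , _) = W-excludes s a

  common⇒¬W : ∀ {x} → Common x → W x ≡ false
  common⇒¬W (a , _) = W-excludes true a

  classify : ∀ {t u} → W t ≡ true → t ~ u → W u ≡ true ⊎ (∃ λ s → Side s u) ⊎ Common u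
  classify {t} {u} wt tu = split k₁ u
    (λ a → split k₂ u (λ b → inj₂ (inj₂ (a , b)))
      λ b → inj₂ (inj₁ (true , a , b , λ { refl → true≢false (~sym tu) (W⇒≁ wt false) })))
    λ a → split k₂ u (λ b → inj₂ (inj₁ (false , b , a , λ { refl → true≢false (~sym tu) (W⇒≁ wt true) })))
      λ b → inj₁ (∧-pair (not-false a) (not-false b))

  -- No induced P₄ starts at x and continues in W: it would extend to a P₆ through the chosen edge.
  short : ∀ {s x w r r′} → Side s x → W w ≡ true → W r ≡ true → W r′ ≡ true →
    x ~ w → w ~ r → r ~ r′ → x ≁ r → x ≁ r′ → w ~ r′
  short {s} {x} {w} {r} {r′} (kx , k′x , _) ww wr wr′ xw wr~ rr′ xr xr′ = split w r′ id λ wr′≁ →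
    ⊥-elim (p₆ (~sym (κκ s)) kx xw wr~ rr′
      k′x (W⇒≁ ww (not s)) (W⇒≁ wr (not s)) (W⇒≁ wr′ (not s))
      (W⇒≁ ww s) (W⇒≁ wr s) (W⇒≁ wr′ s) xr xr′ wr′≁)

  module Component (w₀ : Fin n) (Ww₀ : W w₀ ≡ true) where

    C : Fin n → Set
    C = PathIn G W w₀

    C⇒W : ∀ {c} → C c → W c ≡ true
    C⇒W = path-end

    Att : Bool → Fin n → Set
    Att s x = Side s x × ∃ λ c → C c × x ~ c

    neighbour : ∀ {t u} → C t → t ~ u → C u ⊎ (∃ λ s → Att s u) ⊎ Common u
    neighbour {t} ct tu with classify (C⇒W ct) tu
    ... | inj₁ w                = inj₁ (path-snoc ct tu w)
    ... | inj₂ (inj₁ (s , su))  = inj₂ (inj₁ (s , su , t , ct , ~sym tu))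
    ... | inj₂ (inj₂ cu)        = inj₂ (inj₂ cu)

    -- The common neighbours of the edge form a clique; with nothing attached to `C`, they would cut
    -- it off from `k₁`.
    attached : ¬ ¬ (∃ λ s → ∃ (Att s))
    attached none = noCut (K , clique , w₀ , k₁ ,
        cong₂ _∧_ (W⇒≁ Ww₀ true) refl , cong₂ _∧_ (irrefl G k₁) refl , connected w₀ k₁ ,
        λ p → true≢false (~sym k₁k₂) (W⇒≁ (C⇒W (path-induction C stays p (here Ww₀))) false))
      where
      K : Fin n → Bool
      K v = adj G k₁ v ∧ adj G k₂ v
      clique : IsCliqueSet G K
      clique u v ku kv ne with ∧-split {adj G k₁ u} ku | ∧-split {adj G k₁ v} kv
      ... | a , b | a′ , b′ = ◇ k₁k₂ a b a′ b′ ne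
      stays : ∀ {u v} → not (K u) ≡ true → not (K v) ≡ true → u ~ v → C u → C v
      stays _ nv uv cu with neighbour cu uv
      ... | inj₁ cv                    = cv
      ... | inj₂ (inj₁ (s , a))        = ⊥-elim (none (s , _ , a))
      ... | inj₂ (inj₂ (a , b))        = ⊥-elim (true≢false (∧-pair a b) (not-true nv))

    -- Along a path in `C` from an attachment point, the distance from `x` never reaches three:
    -- `short` moves the same intermediate vertex on.
    dominated : ∀ {s x c} → Att s x → C c → x ~ c ⊎ ∃ λ w → C w × x ~ w × w ~ c
    dominated {s} {x} (sx , c₁ , cc₁ , xc₁) cc =
      proj₂ (path-induction Q next (path-trans (path-sym cc₁) cc) (cc₁ , inj₁ xc₁))
      where
      Q : Fin n → Set
      Q c = C c × (x ~ c ⊎ ∃ λ w → C w × x ~ w × w ~ c)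
      next : ∀ {u v} → W u ≡ true → W v ≡ true → u ~ v → Q u → Q v
      next {u} {v} wu wv uv (cu , q) = path-snoc cu uv wv , split x v inj₁ λ xv → inj₂ (case q of λ where
        (inj₁ xu) → u , cu , xu , uv
        (inj₂ (w , cw , xw , wu~)) → split x u (λ xu → u , cu , xu , uv)
          λ xu → w , cw , xw , short sx (C⇒W cw) wu wv xw wu~ uv xu xv)

    att≢ : ∀ {s x c} → Att s x → C c → x ≢ c
    att≢ (sx , _) cc refl = true≢false (C⇒W cc) (side⇒¬W sx)

    -- Spokes have only the hub and its neighbours around them within the component, which makes them low.
    record Spoke (c : Fin n) : Set where
      constructor spoke
      field
        {side} : Bool
        {x hub third} : Fin n
        att : Att side x
        Cc  : C c
        Ch  : C hub
        Ct  : C third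
        hc  : hub ~ c
        tc  : third ~ c
        ht  : hub ~ third
        xh  : x ~ hub
        x≁c : x ≁ c

      x≁t : x ≁ third
      x≁t = ≁-intro λ xt → true≢false (◇ ht (~sym xh) (~sym xt) hc tc (att≢ att Cc)) x≁c

      -- If `x` sees `r`, the path `x`, `r`, `c`, `third` cannot be induced, so `r` and `hub` are
      -- both common neighbours of the edge from `c` to `third`. If not, the path `x`, `hub`, `c`,
      -- `r` gives the adjacency directly.
      hub-dominates : ∀ {r} → C r → r ~ c → r ≡ hub ⊎ r ~ hub
      hub-dominates {r} cr rc with r ≟ hub
      ... | yes e = inj₁ e
      ... | no ne = inj₂ (split x r
        (λ xr → split r third
          (λ rt → ◇ (~sym tc) (~sym rc) (~sym rt) (~sym hc) (~sym ht) ne)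
          (λ rt → ⊥-elim (true≢false
            (short (proj₁ att) (C⇒W cr) (C⇒W Cc) (C⇒W Ct) xr rc (~sym tc) x≁c x≁t) rt)))
        (λ xr → ~sym (short (proj₁ att) (C⇒W Ch) (C⇒W Cc) (C⇒W cr) xh hc (~sym rc) x≁c xr)))

    -- An intermediate vertex `w` between `x` and `r` would also see `r′` by `short`, making `r` a
    -- spoke with hub `w`.
    independent : ∀ {s x r r′} → Att s x → C r → C r′ → ¬ Spoke r → r ~ r′ → x ≁ r → x ≁ r′ → ⊥
    independent a cr cr′ ¬sp rr′ xr xr′ with dominated a cr
    ... | inj₁ xr~ = true≢false xr~ xr
    ... | inj₂ (w , cw , xw , wr) = ¬sp (spoke a cr cw cr′ wr (~sym rr′)
      (short (proj₁ a) (C⇒W cw) (C⇒W cr) (C⇒W cr′) xw wr rr′ xr xr′) xw xr)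

    TwoHubs : Set
    TwoHubs = ∃ λ c → Σ (Spoke c) λ sp → ∃ λ s → ∃ λ x → Att s x × x ~ c × x ≁ Spoke.hub sp

    -- The vertex `x′` makes `hub` a spoke with hub `c`, so the two roles are interchangeable. Any
    -- `u` that sees both is again a spoke with either hub, so its neighbours stay near both. Thus
    -- `C` consists of `c`, `hub` and common neighbours of this edge.
    two-hubs⇒clique : TwoHubs → ∀ {u v} → C u → C v → u ≢ v → u ~ v
    two-hubs⇒clique (c , sp , s , x′ , att′ , x′c , x′≁h) {u} {v} cu cv ne =
      join (reach cu) (reach cv)
      where
      open Spoke sp
      sp′ : Spoke hub
      sp′ = spoke att′ Ch Cc Ct (~sym hc) (~sym ht) (~sym tc) x′c x′≁h

      Near : Fin n → Set
      Near u = (u ≡ c ⊎ u ~ c) × (u ≡ hub ⊎ u ~ hub)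

      next : ∀ {u v} → W u ≡ true → W v ≡ true → u ~ v → C u × Near u → C v × Near v
      next {u} {v} wu wv uv (cu , q) = Cv , (case q of λ where
          (inj₁ refl , _) → inj₂ (~sym uv) , Spoke.hub-dominates sp Cv (~sym uv)
          (inj₂ _ , inj₁ refl) → Spoke.hub-dominates sp′ Cv (~sym uv) , inj₂ (~sym uv)
          (inj₂ uc , inj₂ uh) →
            Spoke.hub-dominates (spoke att′ cu Cc Ch (~sym uc) (~sym uh) (~sym hc) x′c
              (≁-intro λ e → true≢false (◇ uc (~sym e) (~sym x′c) uh (~sym hc) (att≢ att′ Ch)) x′≁h))
              Cv (~sym uv) ,
            Spoke.hub-dominates (spoke att cu Ch Cc (~sym uh) (~sym uc) hc xh
              (≁-intro λ e → true≢false (◇ uh (~sym e) (~sym xh) uc hc (att≢ att Cc)) x≁c))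
              Cv (~sym uv))
        where
        Cv = path-snoc cu uv wv

      reach : ∀ {u} → C u → Near u
      reach cu = proj₂ (path-induction (λ u → C u × Near u) next
        (path-trans (path-sym Cc) cu) (Cc , inj₁ refl , inj₂ (~sym hc)))

      join : Near u → Near v → u ~ v
      join (inj₁ refl , _) (inj₁ refl , _) = ⊥-elim (ne refl)
      join (inj₁ refl , _) (inj₂ vc , _) = ~sym vc
      join (inj₂ uc , _) (inj₁ refl , _) = uc
      join (_ , inj₁ refl) (_ , inj₁ refl) = ⊥-elim (ne refl)
      join (_ , inj₁ refl) (_ , inj₂ vh) = ~sym vh
      join (_ , inj₂ uh) (_ , inj₁ refl) = uh
      join (inj₂ uc , inj₂ uh) (inj₂ vc , inj₂ vh) = ◇ hc (~sym uh) (~sym uc) (~sym vh) (~sym vc) ne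

-- Colours 0 and 1 are reserved for vertices far from the chosen edge, and 5, 6, … serve its common
-- neighbours; a private neighbour with no neighbour on its own side always gets lo. Thus hi true,
-- lo false and hi false never occur on common neighbours.
module Palette (p : ℕ) where

  Colour : Set
  Colour = Fin (6 + p)

  lo hi : Bool → Colour
  lo true  = 5F
  lo false = 3F
  hi true  = 2F
  hi false = 4F

-- Colouring the vertices outside `W`

module BaseColouring {n : ℕ} (G : Graph n) (p₆ : NoP₆ G) (◇ : NoDiamond G)
  (connected : Connected G) (noCut : ¬ HasCliqueCutset G)
  (k₁ k₂ : Fin n) (k₁k₂ : Adj G k₁ k₂) (light₁ : Light G k₁ k₂) (light₂ : Light G k₂ k₁)
  {p : ℕ} (bound : CliqueBound G (3 + p)) where

  open Base G
  open OffEdge G p₆ ◇ connected noCut k₁ k₂ k₁k₂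
  open Palette p

  light : ∀ s → Light G (κ s) (κ (not s))
  light true  = light₁
  light false = light₂

  side : Bool → Fin n → Bool
  side s x = adj G (κ s) x ∧ (not (adj G (κ (not s)) x) ∧ not (does (x ≟ κ (not s))))

  side⇒Side : ∀ {s x} → side s x ≡ true → Side s x
  side⇒Side {s} {x} e with ∧-split {adj G (κ s) x} e
  ... | a , e′ with ∧-split {not (adj G (κ (not s)) x)} e′
  ... | b , c = a , not-true b , does-no (x ≟ κ (not s)) (not-true c)

  Side⇒side : ∀ {s x} → Side s x → side s x ≡ true
  Side⇒side {s} {x} (a , b , c) = ∧-pair a (∧-pair (not-false b) (not-false (dec-false (x ≟ κ (not s)) c)))

  abstract
    -- Each side induces a matching: two neighbours of `v` on its side would be adjacent by
    -- diamond-freeness and form a triangle that lightness excludes.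
    sideColouring : ∀ s → Colorable (restrict G (side s)) 2
    sideColouring s = two-colour (restrict G (side s)) λ v a b va vb a≢b →
      let sv , sa , va′ = restrict-split G (side s) v a va
          _  , sb , vb′ = restrict-split G (side s) v b vb
          Sv = side⇒Side sv ; Sa = side⇒Side sa ; Sb = side⇒Side sb
      in light s v a b Sv Sa Sb va′ vb′
           (◇ (proj₁ Sv) (proj₁ Sa) va′ (proj₁ Sb) vb′ a≢b)

  common : Fin n → Bool
  common x = adj G k₁ x ∧ adj G k₂ x

  abstract
    -- A vertex seeing all `suc p` colours would lie, with the bearers and both ends of the edge, in
    -- a clique of 4 + p vertices.
    commonColouring : Colorable (restrict G common) (suc p)
    commonColouring = greedy (restrict G common) λ c v → case unseen⊎rainbow (restrict G common) c v of λ where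
        (inj₁ r) → r
        (inj₂ (g , gp)) → ⊥-elim (crowded c v g gp)
      where
      crowded : ∀ (c : Fin n → Fin (suc p)) v (g : Fin (suc p) → Fin n) → (∀ γ → Adj (restrict G common) v (g γ) × c (g γ) ≡ γ) → ⊥
      crowded c v g gp = 1+n≰n (bound (k₁ ◂ k₂ ◂ v ◂ g)
        (◂-clique G (λ { 0F → k₁k₂ ; 1F → proj₁ Cv ; (suc (suc i)) → proj₁ (Cg i) })
        (◂-clique G (λ { 0F → proj₂ Cv ; (suc i) → proj₂ (Cg i) })
        (◂-clique G (λ i → proj₂ (proj₂ (nb i)))
        λ i j i≢j → ◇ k₁k₂ (proj₁ (Cg i)) (proj₂ (Cg i)) (proj₁ (Cg j)) (proj₂ (Cg j))
          λ e → i≢j (trans (≡.sym (proj₂ (gp i))) (trans (cong c e) (proj₂ (gp j))))))))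
        where
        nb : ∀ i → common v ≡ true × common (g i) ≡ true × v ~ g i
        nb i = restrict-split G common v (g i) (proj₁ (gp i))
        Cg : ∀ i → Common (g i)
        Cg i = ∧-split {adj G k₁ (g i)} (proj₁ (proj₂ (nb i)))
        Cv : Common v
        Cv = ∧-split {adj G k₁ v} (proj₁ (nb 0F))

  Crowded : Bool → Fin n → Set
  Crowded s v = ∃ λ y → side s y ≡ true × y ~ v

  crowded? : ∀ s v → Dec (Crowded s v)
  crowded? s v = any? λ y → (side s y Bool.≟ true) ×-dec (adj G y v Bool.≟ true)

  choose : Bool → Fin 2 → Colour
  choose s zero    = lo s
  choose s (suc _) = hi s

  choose-injective : ∀ s i j → choose s i ≡ choose s j → i ≡ j
  choose-injective true  0F 0F _ = refl
  choose-injective true  1F 1F _ = refl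
  choose-injective false 0F 0F _ = refl
  choose-injective false 1F 1F _ = refl

  pick : Bool → Fin n → Fin 2
  pick s v = if does (crowded? s v) then proj₁ (sideColouring s) v else 0F

  choose-opposite : ∀ i j → choose true i ≢ choose false j
  choose-opposite 0F 0F ()
  choose-opposite 0F 1F ()
  choose-opposite 1F 0F ()
  choose-opposite 1F 1F ()

  abstract
    c₀ : Fin n → Colour
    -- Each end of the edge borrows a colour of the opposite side, to which it is not adjacent: `k₂`
    -- takes `hi true` and `k₁` takes `lo false`.
    c₀ v = if adj G k₁ v
      then (if adj G k₂ v then 5 ↑ʳ proj₁ commonColouring v
            else if does (v ≟ k₂) then 2F else choose true (pick true v))
      else (if does (v ≟ k₁) then 3F else choose false (pick false v))

    common₀ : ∀ {v} → Common v → c₀ v ≡ 5 ↑ʳ proj₁ commonColouring v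
    common₀ (a , b) = trans (if-true a) (if-true b)

    side-choice : ∀ {s v} → Side s v → c₀ v ≡ choose s (pick s v)
    side-choice {true}  {v} (a , b , c) = trans (if-true a) (trans (if-false b) (if-false (dec-false (v ≟ k₂) c)))
    side-choice {false} {v} (a , b , c) = trans (if-false b) (if-false (dec-false (v ≟ k₁) c))

    k₁-colour : c₀ k₁ ≡ 3F
    k₁-colour = trans (if-false (irrefl G k₁)) (if-true (dec-true (k₁ ≟ k₁) refl))

    k₂-colour : c₀ k₂ ≡ 2F
    k₂-colour = trans (if-true k₁k₂) (trans (if-false (irrefl G k₂)) (if-true (dec-true (k₂ ≟ k₂) refl)))

  -- The colour `hi s` thus certifies a neighbour on the same side. That neighbour is the extra
  -- vertex needed by `lonely` and `crowded-apart`.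
  side₀ : ∀ {s x} → Side s x → c₀ x ≡ lo s ⊎ (c₀ x ≡ hi s × ∃ λ y → Side s y × y ~ x)
  side₀ {s} {x} sx = case crowded? s x of λ where
      (no ¬c) → inj₁ (trans (side-choice sx) (cong (choose s) (if-false (dec-false (crowded? s x) ¬c))))
      (yes (y , sy , yx)) → by-value (y , side⇒Side sy , yx) (pick s x) (side-choice sx)
    where
    by-value : (∃ λ y → Side s y × y ~ x) → ∀ i → c₀ x ≡ choose s i →
      c₀ x ≡ lo s ⊎ (c₀ x ≡ hi s × ∃ λ y → Side s y × y ~ x)
    by-value _ 0F e = inj₁ e
    by-value y 1F e = inj₂ (e , y)

  data View (v : Fin n) : Set where
    isCommon : Common v → View v
    isSide   : ∀ s → Side s v → View v
    isκ      : ∀ s → v ≡ κ s → View v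

  view : ∀ v → W v ≡ false → View v
  view v w = split k₁ v
    (λ a → split k₂ v (λ b → isCommon (a , b)) λ b → case v ≟ k₂ of λ where
      (yes e) → isκ false e
      (no ne) → isSide true (a , b , ne))
    λ a → split k₂ v
      (λ b → case v ≟ k₁ of λ where
        (yes e) → isκ true e
        (no ne) → isSide false (b , a , ne))
      λ b → ⊥-elim (true≢false (∧-pair (not-false a) (not-false b)) w)

  -- Otherwise `x` and the other end of the edge would be common neighbours of one end and `u`,
  -- hence adjacent. This is what permits `lo true` to be the first common colour.
  common≁side : ∀ {u x} s → Common u → Side s x → u ≁ x
  common≁side {u} {x} true (a , b) (c , d , e) = ≁-intro λ ux →
    true≢false (~sym (◇ a c ux k₁k₂ (~sym b) e)) d
  common≁side {u} {x} false (a , b) (c , d , e) = ≁-intro λ ux →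
    true≢false (~sym (◇ b c ux (~sym k₁k₂) (~sym a) e)) d

  same-side : ∀ {s u v} → Side s u → Side s v → u ~ v → choose s (pick s u) ≢ choose s (pick s v)
  same-side {s} {u} {v} su sv uv e =
    proj₂ (sideColouring s) u v (restrict-pair G (side s) u v (Side⇒side su) (Side⇒side sv) uv)
      (trans (≡.sym (raw (v , Side⇒side sv , ~sym uv)))
        (trans (choose-injective s (pick s u) (pick s v) e) (raw (u , Side⇒side su , uv))))
    where
    raw : ∀ {w} → Crowded s w → pick s w ≡ proj₁ (sideColouring s) w
    raw {w} cr = if-true (dec-true (crowded? s w) cr)

  proper₀ : ∀ u v → W u ≡ false → W v ≡ false → u ~ v → c₀ u ≢ c₀ v
  proper₀ u v wu wv uv e = clash (view u wu) (view v wv) uv e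
    where
    side≢κ : ∀ {u v} s t → Side s u → v ≡ κ t → u ~ v → c₀ u ≢ c₀ v
    side≢κ true  false (_ , b , _) refl uv _ = true≢false (~sym uv) b
    side≢κ false true  (_ , b , _) refl uv _ = true≢false (~sym uv) b
    side≢κ {u} true  true  su refl uv e = ≢3 (pick true u) (trans (≡.sym (side-choice su)) (trans e k₁-colour))
      where
      ≢3 : ∀ i → choose true i ≢ 3F
      ≢3 0F ()
      ≢3 1F ()
    side≢κ {u} false false su refl uv e = ≢2 (pick false u) (trans (≡.sym (side-choice su)) (trans e k₂-colour))
      where
      ≢2 : ∀ i → choose false i ≢ 2F
      ≢2 0F ()
      ≢2 1F ()

    common≢κ : ∀ {u v} t → Common u → v ≡ κ t → c₀ u ≢ c₀ v
    common≢κ true  cu refl e = case trans (≡.sym (common₀ cu)) (trans e k₁-colour) of λ ()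
    common≢κ false cu refl e = case trans (≡.sym (common₀ cu)) (trans e k₂-colour) of λ ()

    clash : ∀ {u v} → View u → View v → u ~ v → c₀ u ≢ c₀ v
    clash {u} {v} (isCommon cu) (isCommon cv) uv e =
      proj₂ commonColouring u v (restrict-pair G common u v (∧-pair (proj₁ cu) (proj₂ cu)) (∧-pair (proj₁ cv) (proj₂ cv)) uv)
        (↑ʳ-injective 5 _ _ (trans (≡.sym (common₀ cu)) (trans e (common₀ cv))))
    clash (isCommon cu) (isSide s sv) uv e = true≢false uv (common≁side s cu sv)
    clash (isSide s su) (isCommon cv) uv e = true≢false (~sym uv) (common≁side s cv su)
    clash (isCommon cu) (isκ t q) uv e = common≢κ t cu q e
    clash (isκ t q) (isCommon cv) uv e = common≢κ t cv q (≡.sym e)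
    clash (isSide s su) (isκ t q) uv e = side≢κ s t su q uv e
    clash (isκ t q) (isSide s sv) uv e = side≢κ s t sv q (~sym uv) (≡.sym e)
    clash (isSide true su) (isSide true sv) uv e =
      same-side su sv uv (trans (≡.sym (side-choice su)) (trans e (side-choice sv)))
    clash (isSide false su) (isSide false sv) uv e =
      same-side su sv uv (trans (≡.sym (side-choice su)) (trans e (side-choice sv)))
    clash {u} {v} (isSide true su) (isSide false sv) uv e =
      choose-opposite (pick true u) (pick false v) (trans (≡.sym (side-choice su)) (trans e (side-choice sv)))
    clash {u} {v} (isSide false su) (isSide true sv) uv e =
      choose-opposite (pick true v) (pick false u) (trans (≡.sym (side-choice sv)) (trans (≡.sym e) (side-choice su)))
    clash (isκ true refl) (isκ true refl) uv e = ~⇒≢ uv refl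
    clash (isκ false refl) (isκ false refl) uv e = ~⇒≢ uv refl
    clash (isκ true refl) (isκ false refl) uv e = case trans (≡.sym k₁-colour) (trans e k₂-colour) of λ ()
    clash (isκ false refl) (isκ true refl) uv e = case trans (≡.sym k₂-colour) (trans e k₁-colour) of λ ()

-- Colouring one component of `W`

module ComponentColouring {n : ℕ} (G : Graph n) (p₆ : NoP₆ G) (◇ : NoDiamond G)
  (connected : Connected G) (noCut : ¬ HasCliqueCutset G)
  (k₁ k₂ : Fin n) (k₁k₂ : Adj G k₁ k₂)
  {p : ℕ} (bound : CliqueBound G (3 + p)) where

  open Base G
  open OffEdge G p₆ ◇ connected noCut k₁ k₂ k₁k₂
  open Palette p

  module Over
    (c₀ : Fin n → Colour)
    (proper₀ : ∀ u v → W u ≡ false → W v ≡ false → Adj G u v → c₀ u ≢ c₀ v)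
    (common₀ : ∀ {v} → Common v → ∃ λ i → c₀ v ≡ 5 ↑ʳ i)
    (side₀ : ∀ {s x} → Side s x → c₀ x ≡ lo s ⊎ (c₀ x ≡ hi s × ∃ λ y → Side s y × Adj G y x)) where

    -- The value nothing marks vertices left to the final greedy extension, which works where Low holds.
    Partial : Set
    Partial = Fin n → Maybe Colour

    onto : Partial → Partial
    onto D u = if W u then D u else just (c₀ u)

    onto-in : ∀ D {u} → W u ≡ true → onto D u ≡ D u
    onto-in D w = if-true w

    onto-out : ∀ D {u} → W u ≡ false → onto D u ≡ just (c₀ u)
    onto-out D w = if-false w

    -- As `nothing` is never among the three values, neighbours still uncoloured must lie in the
    -- clique.
    Low : Partial → Fin n → Set
    Low E v = ∃ λ α → ∃ λ β → ∃ λ δ → ∀ u u′ → v ~ u → v ~ u′ → u ≢ u′ →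
      ¬ Among (just α) (just β) (just δ) (E u) → ¬ Among (just α) (just β) (just δ) (E u′) → u ~ u′

    -- Neighbours of the component lie in it or outside `W`, so only the values of `D` on the
    -- component matter. Hence solutions for different components can be patched.
    Good : Fin n → Partial → Set
    Good w₀ D = ∀ v → PathIn G W w₀ v →
      (∀ a → D v ≡ just a → ∀ u → v ~ u → onto D u ≢ just a) × (D v ≡ nothing → Low (onto D) v)

    side-bound : ∀ {s x} → Side s x → c₀ x ≡ lo s ⊎ c₀ x ≡ hi s
    side-bound sx = [ inj₁ , (λ q → inj₂ (proj₁ q)) ] (side₀ sx)

    side≢01 : ∀ {s x} → Side s x → c₀ x ≢ 0F × c₀ x ≢ 1F
    side≢01 {true}  sx with side-bound sx
    ... | inj₁ e rewrite e = (λ ()) , λ ()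
    ... | inj₂ e rewrite e = (λ ()) , λ ()
    side≢01 {false} sx with side-bound sx
    ... | inj₁ e rewrite e = (λ ()) , λ ()
    ... | inj₂ e rewrite e = (λ ()) , λ ()

    common≢01 : ∀ {x} → Common x → c₀ x ≢ 0F × c₀ x ≢ 1F
    common≢01 cx with common₀ cx
    ... | i , e rewrite e = (λ ()) , λ ()

    common≢hi : ∀ {x} s → Common x → c₀ x ≢ hi s
    common≢hi true cx with common₀ cx
    ... | i , e rewrite e = λ ()
    common≢hi false cx with common₀ cx
    ... | i , e rewrite e = λ ()

    -- Two common neighbours seen by `t` would be adjacent, and then `t` and `k₁` would be common
    -- neighbours of that edge. The value `0F` is a dummy when there is none.
    common-once : ∀ {t} → W t ≡ true → ∃ λ γ → ∀ u → Common u → t ~ u → c₀ u ≡ γ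
    common-once {t} wt with any? (λ u → (adj G k₁ u Bool.≟ true) ×-dec ((adj G k₂ u Bool.≟ true) ×-dec (adj G t u Bool.≟ true)))
    ... | no none = 0F , λ u (a , b) tu → ⊥-elim (none (u , a , b , tu))
    ... | yes (u , a , b , tu) = c₀ u , λ u′ (a′ , b′) tu′ → same u′ a′ b′ tu′
      where
      same : ∀ u′ → k₁ ~ u′ → k₂ ~ u′ → t ~ u′ → c₀ u′ ≡ c₀ u
      same u′ a′ b′ tu′ with u′ ≟ u
      ... | yes e = cong c₀ e
      ... | no ne = ⊥-elim (true≢false
        (~sym (◇ (◇ k₁k₂ a′ b′ a b ne) (~sym tu′) (~sym tu) (~sym a′) (~sym a)
          λ { refl → true≢false (~sym k₁k₂) (W⇒≁ wt false) }))
        (W⇒≁ wt true))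

    module _ (w₀ : Fin n) (Ww₀ : W w₀ ≡ true) where

      open Component w₀ Ww₀

      outside : ∀ {t u} → C t → t ~ u → C u ⊎ (W u ≡ false × c₀ u ≢ 0F × c₀ u ≢ 1F)
      outside ct tu with neighbour ct tu
      ... | inj₁ cu                     = inj₁ cu
      ... | inj₂ (inj₁ (s , su , _))    = inj₂ (side⇒¬W su , side≢01 su)
      ... | inj₂ (inj₂ cu)              = inj₂ (common⇒¬W cu , common≢01 cu)

      -- Among any three vertices of a clique component one is low, so colours 0 and 1 suffice for the rest.
      module CliqueCase (clique : ∀ {u v} → C u → C v → u ≢ v → u ~ v)
        {a b : Fin n} (Ca : C a) (Cb : C b) (a≢b : a ≢ b) where

        Complete : Fin n → Set
        Complete x = ∀ r → C r → x ~ r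

        complete : ∀ {x t r} → W x ≡ false → C t → C r → t ≢ r → x ~ t → x ~ r → Complete x
        complete {x} {t} {r} wx ct cr t≢r xt xr q cq with q ≟ t | q ≟ r
        ... | yes refl | _        = xt
        ... | no _     | yes refl = xr
        ... | no qt    | no qr    = ◇ (clique ct cr t≢r) (~sym xt) (~sym xr)
          (clique ct cq (qt ∘ ≡.sym)) (clique cr cq (qr ∘ ≡.sym)) λ { refl → true≢false (C⇒W cq) wx }

        other : ∀ t → C t → ∃ λ t′ → C t′ × t ≢ t′
        other t ct with t ≟ a
        ... | yes refl = b , Cb , a≢b
        ... | no ne    = a , Ca , ne

        LowHere : Fin n → Set
        LowHere t = ∃ λ α → ∃ λ β → ∃ λ δ → ∀ u → W u ≡ false → t ~ u →
          Among α β δ (c₀ u) ⊎ Complete u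

        just-among : ∀ {α β δ x : Colour} → Among α β δ x → Among (just α) (just β) (just δ) (just x)
        just-among (inj₁ refl)        = inj₁ refl
        just-among (inj₂ (inj₁ refl)) = inj₂ (inj₁ refl)
        just-among (inj₂ (inj₂ refl)) = inj₂ (inj₂ refl)

        -- Complete vertices form a clique with `C`: any two of them share an edge of `C` through
        -- `t`.
        low : ∀ {t} D → C t → LowHere t → Low (onto D) t
        low {t} D ct (α , β , δ , h) = α , β , δ , λ u u′ tu tu′ ne q q′ →
          join ne tu tu′ (kind tu q) (kind tu′ q′)
          where
          kind : ∀ {u} → t ~ u → ¬ Among (just α) (just β) (just δ) (onto D u) → C u ⊎ (W u ≡ false × Complete u)
          kind {u} tu q with outside ct tu
          ... | inj₁ cu = inj₁ cu
          ... | inj₂ (wu , _) with h u wu tu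
          ...   | inj₂ full = inj₂ (wu , full)
          ...   | inj₁ am   = ⊥-elim (q (subst (Among _ _ _) (≡.sym (onto-out D wu)) (just-among am)))
          join : ∀ {u u′} → u ≢ u′ → t ~ u → t ~ u′ → C u ⊎ (W u ≡ false × Complete u) →
            C u′ ⊎ (W u′ ≡ false × Complete u′) → u ~ u′
          join ne _ _ (inj₁ cu) (inj₁ cu′) = clique cu cu′ ne
          join ne _ _ (inj₁ cu) (inj₂ (_ , full)) = ~sym (full _ cu)
          join ne _ _ (inj₂ (_ , full)) (inj₁ cu) = full _ cu
          join ne tu tu′ (inj₂ (_ , full)) (inj₂ (_ , full′)) with other t ct
          ... | t′ , ct′ , ne′ = ◇ (clique ct ct′ ne′) tu (~sym (full _ ct′)) tu′ (~sym (full′ _ ct′)) ne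

        Own : Bool → Fin n → Set
        Own s t = ∃ λ x → Side s x × x ~ t × ¬ Complete x

        own-only : ∀ {x t r} → W x ≡ false → ¬ Complete x → C t → C r → t ≢ r → x ~ t → x ≁ r
        own-only wx ¬full ct cr ne xt = ≁-intro λ xr → ¬full (complete wx ct cr ne xt xr)

        complete? : ∀ {x t} → W x ≡ false → C t → x ~ t → Complete x ⊎ ¬ Complete x
        complete? {x} {t} wx ct xt with other t ct
        ... | t′ , ct′ , ne = split x t′ (λ xt′ → inj₁ (complete wx ct ct′ ne xt xt′))
          λ xt′ → inj₂ λ full → true≢false (full _ ct′) xt′

        low-by : ∀ {t} → C t → (α β : Colour) →
          (∀ s {u} → Side s u → u ~ t → ¬ Complete u → c₀ u ≡ α ⊎ c₀ u ≡ β) → LowHere t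
        low-by {t} ct α β h with common-once (C⇒W ct)
        ... | γ , once = α , β , γ , sort
          where
          sort : ∀ u → W u ≡ false → t ~ u → Among α β γ (c₀ u) ⊎ Complete u
          sort u wu tu with neighbour ct tu
          ... | inj₁ cu          = ⊥-elim (true≢false (C⇒W cu) wu)
          ... | inj₂ (inj₂ cu)   = inj₁ (inj₂ (inj₂ (once u cu tu)))
          ... | inj₂ (inj₁ (s , su , _)) with complete? wu ct (~sym tu)
          ...   | inj₁ full  = inj₂ full
          ...   | inj₂ ¬full with h s su (~sym tu) ¬full
          ...     | inj₁ e = inj₁ (inj₁ e)
          ...     | inj₂ e = inj₁ (inj₂ (inj₁ e))

        -- If one side had no own vertex at `t`, the two colours of the other side and that of the
        -- common neighbour would be all that is lost.
        own : ∀ {t} → C t → ¬ LowHere t → ∀ s → ¬ ¬ Own s t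
        own {t} ct ¬low s none = ¬low (low-by ct (lo (not s)) (hi (not s)) (sort s none))
          where
          sort : ∀ s → ¬ Own s t → ∀ s′ {u} → Side s′ u → u ~ t → ¬ Complete u →
            c₀ u ≡ lo (not s) ⊎ c₀ u ≡ hi (not s)
          sort true  none true  su ut ¬full = ⊥-elim (none (_ , su , ut , ¬full))
          sort false none false su ut ¬full = ⊥-elim (none (_ , su , ut , ¬full))
          sort true  none false su ut ¬full = side-bound su
          sort false none true  su ut ¬full = side-bound su

        -- Otherwise `r`, `t`, `y`, `a`, `b`, `x` induce a P₆.
        cross : ∀ {a b r t x y} → a ~ b → (∀ {c} → C c → a ≁ c) → (∀ {c} → C c → b ≁ c) →
          C r → C t → r ≢ t → Private G a b y → Private G b a x →
          y ~ t → y ≁ r → x ≁ t → x ≁ r → y ~ x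
        cross {x = x} {y} ab a≁ b≁ cr ct r≢t (ay , by , _) (bx , ax , _) yt yr xt xr = split y x id λ yx →
          ⊥-elim (p₆ (clique cr ct r≢t) (~sym yt) (~sym ay) ab bx
            (≁sym yr) (≁sym (a≁ cr)) (≁sym (b≁ cr)) (≁sym xr)
            (≁sym (a≁ ct)) (≁sym (b≁ ct)) (≁sym xt) (≁sym by) yx ax)

        -- The neighbour `y′` misses `t₁`, hence also one of `t₂` and `t₃`. Let `x` be the own
        -- vertex there. By `cross` both `y` and `y′` see `x`, so `x` and `a` are common neighbours
        -- of the edge from `y` to `y′`, although `x` is not adjacent to `a`.
        lonely : ∀ {a b t₁ t₂ t₃ x₂ x₃ y y′} → a ~ b → (∀ {c} → C c → a ≁ c) → (∀ {c} → C c → b ≁ c) →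
          (∀ {x} → a ~ x → W x ≡ false) → (∀ {x} → b ~ x → W x ≡ false) →
          C t₁ → C t₂ → C t₃ → t₁ ≢ t₂ → t₁ ≢ t₃ → t₂ ≢ t₃ →
          Private G b a x₂ → x₂ ~ t₂ → ¬ Complete x₂ → Private G b a x₃ → x₃ ~ t₃ → ¬ Complete x₃ →
          Private G a b y → y ~ t₁ → ¬ Complete y → Private G a b y′ → y′ ~ y → ⊥
        lonely {a} {b} {t₁} {t₂} {t₃} {x₂} {x₃} {y} {y′} ab a≁ b≁ wa wb c₁ c₂ c₃ n₁₂ n₁₃ n₂₃
          X₂ x₂t₂ ¬f₂ X₃ x₃t₃ ¬f₃ Y yt₁ ¬fy Y′ y′y =
          split y′ t₂
            (λ y′t₂ → finish c₃ c₂ (n₂₃ ∘ ≡.sym) n₁₃ n₁₂ X₃ x₃t₃ ¬f₃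
              (≁-intro λ y′t₃ → true≢false (complete (wa (proj₁ Y′)) c₂ c₃ n₂₃ y′t₂ y′t₃ _ c₁) y′≁t₁))
            (λ y′t₂ → finish c₂ c₃ n₂₃ n₁₂ n₁₃ X₂ x₂t₂ ¬f₂ y′t₂)
          where
          y′≁t₁ : y′ ≁ t₁
          y′≁t₁ = ≁-intro λ q → true≢false
            (◇ y′y (~sym (proj₁ Y′)) (~sym (proj₁ Y)) q yt₁ λ { refl → true≢false (C⇒W c₁) (wb (~sym ab)) }) (a≁ c₁)
          finish : ∀ {t r x} → C t → C r → t ≢ r → t₁ ≢ t → t₁ ≢ r →
            Private G b a x → x ~ t → ¬ Complete x → y′ ≁ t → ⊥
          finish {t} {r} {x} ct cr t≢r n₁t n₁r X xt ¬fx y′t =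
            true≢false
              (◇ y′y (~sym (proj₁ Y′)) (~sym (proj₁ Y)) (~sym xy′) yx λ { refl → proj₂ (proj₂ X) refl })
              (proj₁ (proj₂ X))
            where
            x≁t₁ : x ≁ t₁
            x≁t₁ = own-only (wb (proj₁ X)) ¬fx ct c₁ (n₁t ∘ ≡.sym) xt
            x≁r : x ≁ r
            x≁r = own-only (wb (proj₁ X)) ¬fx ct cr t≢r xt
            yx : y ~ x
            yx = cross ab a≁ b≁ cr c₁ (n₁r ∘ ≡.sym) Y X yt₁
              (own-only (wa (proj₁ Y)) ¬fy c₁ cr n₁r yt₁) x≁t₁ x≁r
            xy′ : x ~ y′
            xy′ = cross (~sym ab) b≁ a≁ c₁ ct n₁t X Y′ xt x≁t₁ y′t y′≁t₁

        -- Own vertices of both sides at `t₂` and `t₃` leave those at `t₁` without neighbours on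
        -- their own side, by `lonely`. They bear only the colours `lo`, one per side, which makes
        -- `t₁` low.
        some-low : ∀ {t₁ t₂ t₃} → C t₁ → C t₂ → C t₃ → t₁ ≢ t₂ → t₁ ≢ t₃ → t₂ ≢ t₃ →
          ¬ LowHere t₁ → ¬ LowHere t₂ → ¬ LowHere t₃ → ⊥
        some-low {t₁} {t₂} {t₃} c₁ c₂ c₃ n₁₂ n₁₃ n₂₃ ¬l₁ ¬l₂ ¬l₃ =
          own c₂ ¬l₂ true λ (x₂ , X₂ , x₂t , ¬f₂) → own c₂ ¬l₂ false λ (z₂ , Z₂ , z₂t , ¬g₂) →
          own c₃ ¬l₃ true λ (x₃ , X₃ , x₃t , ¬f₃) → own c₃ ¬l₃ false λ (z₃ , Z₃ , z₃t , ¬g₃) →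
          ¬l₁ (low-by c₁ (lo true) (lo false) λ where
            true su ut ¬full → inj₁ (case side₀ su of λ where
              (inj₁ e) → e
              (inj₂ (_ , y , sy , yu)) → ⊥-elim (lonely k₁k₂ (λ c → W⇒≁ (C⇒W c) true) (λ c → W⇒≁ (C⇒W c) false)
                (W-excludes true) (W-excludes false) c₁ c₂ c₃ n₁₂ n₁₃ n₂₃ Z₂ z₂t ¬g₂ Z₃ z₃t ¬g₃ su ut ¬full sy yu))
            false su ut ¬full → inj₂ (case side₀ su of λ where
              (inj₁ e) → e
              (inj₂ (_ , y , sy , yu)) → ⊥-elim (lonely (~sym k₁k₂) (λ c → W⇒≁ (C⇒W c) false) (λ c → W⇒≁ (C⇒W c) true)
                (W-excludes false) (W-excludes true) c₁ c₂ c₃ n₁₂ n₁₃ n₂₃ X₂ x₂t ¬f₂ X₃ x₃t ¬f₃ su ut ¬full sy yu)))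

        clique-good : ¬ ¬ ∃ (Good w₀)
        clique-good =
          dec-pred LowHere >>= λ low? →
          em (∃ λ q → C q × ¬ LowHere q) >>= λ where
            (no all-low) → return ((λ _ → nothing) , λ v cv → (λ _ ()) , λ _ →
              low _ cv (decidable-stable (low? v) λ ¬l → all-low (v , cv , ¬l)))
            (yes (q , cq , ¬lq)) → return (D low? q , good low? q cq ¬lq)
          where
          D : (∀ v → Dec (LowHere v)) → Fin n → Partial
          D low? q v = if does (low? v) then nothing else just (if does (v ≟ q) then 0F else 1F)
          good : (low? : ∀ v → Dec (LowHere v)) → ∀ q → C q → ¬ LowHere q → Good w₀ (D low? q)
          good low? q cq ¬lq v cv = proper , uncoloured
            where
            E = D low? q
            uncoloured : E v ≡ nothing → Low (onto E) v
            uncoloured e with low? v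
            ... | yes l = low E cv l
            ... | no _ with () ← e
            value : ∀ {u a} → E u ≡ just a → ¬ LowHere u × ((u ≡ q × a ≡ 0F) ⊎ (u ≢ q × a ≡ 1F))
            value {u} e with low? u | u ≟ q
            ... | no ¬l | yes eq = ¬l , inj₁ (eq , ≡.sym (just-injective e))
            ... | no ¬l | no ne  = ¬l , inj₂ (ne , ≡.sym (just-injective e))
            proper : ∀ a → E v ≡ just a → ∀ u → v ~ u → onto E u ≢ just a
            proper a e u vu e′ with outside cv vu | value e
            ... | inj₂ (wu , ≢0 , ≢1) | _ , inj₁ (_ , refl) = ≢0 (just-injective (trans (≡.sym (onto-out E wu)) e′))
            ... | inj₂ (wu , ≢0 , ≢1) | _ , inj₂ (_ , refl) = ≢1 (just-injective (trans (≡.sym (onto-out E wu)) e′))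
            ... | inj₁ cu | ¬lv , at with value {u} (trans (≡.sym (onto-in E (C⇒W cu))) e′) | at
            ...   | _ , inj₁ (refl , refl) | inj₁ (refl , _) = ~⇒≢ vu refl
            ...   | _ , inj₁ (_ , refl) | inj₂ (_ , ())
            ...   | _ , inj₂ (_ , refl) | inj₁ (_ , ())
            ...   | ¬lu , inj₂ (u≢q , _) | inj₂ (v≢q , _) =
              some-low cq cv cu (v≢q ∘ ≡.sym) (u≢q ∘ ≡.sym) (~⇒≢ vu) ¬lq ¬lv ¬lu

      -- Components where every attached neighbour of a spoke also sees its hub

      module OneHub (¬two : ¬ TwoHubs) (C? : ∀ v → Dec (C v)) (spoke? : ∀ v → Dec (Spoke v)) where

        H : Fin n → Bool
        H v = does (C? v) ∧ not (does (spoke? v))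

        H⇒ : ∀ {v} → H v ≡ true → C v × ¬ Spoke v
        H⇒ {v} h with ∧-split {does (C? v)} h
        ... | a , b = does-yes (C? v) a , does-no (spoke? v) (not-true b)

        H⇒C : ∀ {v} → H v ≡ true → C v
        H⇒C h = proj₁ (H⇒ h)

        -- All neighbours of a spoke, apart from one common neighbour, are its hub or common
        -- neighbours of spoke and hub, hence form a clique.
        spoke-low : ∀ D {c} → Spoke c → Low (onto D) c
        spoke-low D {c} sp with common-once (C⇒W (Spoke.Cc sp))
        ... | γ , once = γ , γ , γ , λ u u′ cu cu′ ne q q′ → join ne cu cu′ (near cu q) (near cu′ q′)
          where
          open Spoke sp
          near : ∀ {u} → c ~ u → ¬ Among (just γ) (just γ) (just γ) (onto D u) → u ≡ hub ⊎ u ~ hub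
          near {u} cu q with neighbour Cc cu
          ... | inj₁ Cu = hub-dominates Cu (~sym cu)
          ... | inj₂ (inj₂ co) = ⊥-elim (q (inj₁ (trans (onto-out D (common⇒¬W co)) (cong just (once u co cu)))))
          ... | inj₂ (inj₁ (s , a)) = inj₂ (split u hub id λ u≁h → ⊥-elim (¬two (c , sp , s , u , a , ~sym cu , u≁h)))
          join : ∀ {u u′} → u ≢ u′ → c ~ u → c ~ u′ → u ≡ hub ⊎ u ~ hub → u′ ≡ hub ⊎ u′ ~ hub → u ~ u′
          join ne _ _ (inj₁ refl) (inj₁ refl) = ⊥-elim (ne refl)
          join ne _ _ (inj₁ refl) (inj₂ b) = ~sym b
          join ne _ _ (inj₂ a) (inj₁ refl) = a
          join ne cu cu′ (inj₂ a) (inj₂ b) = ◇ hc (~sym a) cu (~sym b) cu′ ne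

        finish : (col : Fin n → Colour) →
          (∀ u v → H u ≡ true → H v ≡ true → u ~ v → col u ≢ col v) →
          (∀ v → H v ≡ true → ∀ u → W u ≡ false → v ~ u → c₀ u ≢ col v) → ∃ (Good w₀)
        finish col inner outer = D , λ v cv → proper v cv , uncoloured v cv
          where
          D : Partial
          D v = if H v then just (col v) else nothing
          value : ∀ {v a} → D v ≡ just a → H v ≡ true × col v ≡ a
          value {v} e with H v
          ... | true = refl , just-injective e
          uncoloured : ∀ v → C v → D v ≡ nothing → Low (onto D) v
          uncoloured v cv e with C? v | spoke? v
          ... | yes _ | yes sp = spoke-low D sp
          ... | no ¬c | _ = ⊥-elim (¬c cv)
          ... | yes _ | no _ with () ← e
          proper : ∀ v → C v → ∀ a → D v ≡ just a → ∀ u → v ~ u → onto D u ≢ just a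
          proper v cv a e u vu e′ with value e | outside cv vu
          ... | hv , refl | inj₂ (wu , _) = outer v hv u wu vu (just-injective (trans (≡.sym (onto-out D wu)) e′))
          ... | hv , refl | inj₁ cu with value {u} (trans (≡.sym (onto-in D (C⇒W cu))) e′)
          ...   | hu , eq = inner v u hv hu vu (≡.sym eq)

        H-independent : ∀ {s x r r′} → Att s x → H r ≡ true → H r′ ≡ true → r ~ r′ → x ≁ r → x ≁ r′ → ⊥
        H-independent a hr hr′ = independent a (H⇒C hr) (H⇒C hr′) (proj₂ (H⇒ hr))

        -- The non-neighbours of f get hi s₀. A neighbour v of f then loses at most hi s₀, γ and the colour of
        -- one common neighbour, besides those of the clique formed by v, f and their common neighbours.
        module Few (few : ∀ {s x x′} → Att s x → Att s x′ → x ≡ x′) {s₀ f} (f-att : Att s₀ f)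
          (γ : Colour) (γ-other : ∀ x → Att (not s₀) x → c₀ x ≡ γ) where

          R P : Fin n → Bool
          R u = not (W u) ∨ H u
          P u = not (W u) ∨ (H u ∧ not (adj G f u))

          c₁ : Fin n → Colour
          c₁ u = if W u then hi s₀ else c₀ u

          ∨-cases : ∀ {a b} → not a ∨ b ≡ true → a ≡ false ⊎ (a ≡ true × b ≡ true)
          ∨-cases {true}  e = inj₂ (refl , e)
          ∨-cases {false} e = inj₁ refl

          ∨-out : ∀ {a b} → a ≡ false → not a ∨ b ≡ true
          ∨-out refl = refl

          ∨-in : ∀ {a b} → b ≡ true → not a ∨ b ≡ true
          ∨-in {true}  refl = refl
          ∨-in {false} refl = refl

          attached-neighbour : ∀ {v u} → C v → W u ≡ false → v ~ u → u ≡ f ⊎ Att (not s₀) u ⊎ Common u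
          attached-neighbour cv wu vu with neighbour cv vu
          ... | inj₁ cu = ⊥-elim (true≢false (C⇒W cu) wu)
          ... | inj₂ (inj₂ co) = inj₂ (inj₂ co)
          ... | inj₂ (inj₁ (s , a)) = which s s₀ a f-att
            where
            which : ∀ s s₀ {u f} → Att s u → Att s₀ f → u ≡ f ⊎ Att (not s₀) u ⊎ Common u
            which true  true  a b = inj₁ (few a b)
            which false false a b = inj₁ (few a b)
            which true  false a b = inj₂ (inj₁ a)
            which false true  a b = inj₂ (inj₁ a)

          opposite≢hi : ∀ s {x} → Side (not s) x → c₀ x ≢ hi s
          opposite≢hi true sx with side-bound sx
          ... | inj₁ e rewrite e = λ ()
          ... | inj₂ e rewrite e = λ ()
          opposite≢hi false sx with side-bound sx
          ... | inj₁ e rewrite e = λ ()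
          ... | inj₂ e rewrite e = λ ()

          P-cases : ∀ {v} → P v ≡ true → W v ≡ false ⊎ (W v ≡ true × H v ≡ true × f ≁ v)
          P-cases {v} e with ∨-cases {W v} e
          ... | inj₁ w = inj₁ w
          ... | inj₂ (w , e′) with ∧-split {H v} e′
          ...   | h , b = inj₂ (w , h , not-true b)

          c₁-out : ∀ {v} → W v ≡ false → c₁ v ≡ c₀ v
          c₁-out w = if-false w

          c₁-in : ∀ {v} → W v ≡ true → c₁ v ≡ hi s₀
          c₁-in w = if-true w

          -- On its side only `f` is attached, and `hi s₀` occurs neither on the other side nor on
          -- common neighbours; `lo true` would fail the last point.
          far≢ : ∀ {v u} → H v ≡ true → f ≁ v → W u ≡ false → v ~ u → c₀ u ≢ hi s₀
          far≢ hv fv wu vu with attached-neighbour (H⇒C hv) wu vu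
          ... | inj₁ refl = λ _ → true≢false (~sym vu) fv
          ... | inj₂ (inj₁ a) = opposite≢hi s₀ (proj₁ a)
          ... | inj₂ (inj₂ co) = common≢hi s₀ co

          G₁ : Graph n
          G₁ = restrict G R

          proper₁ : ∀ u v → P u ≡ true → P v ≡ true → Adj G₁ u v → c₁ u ≢ c₁ v
          proper₁ u v pu pv a e with restrict-split G R u v a
          ... | _ , _ , uv with P-cases pu | P-cases pv
          ...   | inj₁ wu | inj₁ wv = proper₀ u v wu wv uv (trans (≡.sym (c₁-out wu)) (trans e (c₁-out wv)))
          ...   | inj₂ (_ , hu , fu) | inj₂ (_ , hv , fv) = H-independent f-att hu hv uv fu fv
          ...   | inj₁ wu | inj₂ (wv , hv , fv) =
            far≢ hv fv wu (~sym uv) (trans (≡.sym (c₁-out wu)) (trans e (c₁-in wv)))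
          ...   | inj₂ (wu , hu , fu) | inj₁ wv =
            far≢ hu fu wv uv (trans (≡.sym (c₁-out wv)) (trans (≡.sym e) (c₁-in wu)))

          bound₁ : CliqueBound G₁ (3 + p)
          bound₁ g clique = bound g λ i j ne → proj₂ (proj₂ (restrict-split G R (g i) (g j) (clique i j ne)))

          free₁ : ∀ v → P v ≡ false → ∀ c → (∀ u → P u ≡ true → c u ≡ c₁ u) → Unseen G₁ c v
          free₁ v pv c agree with true⊎false (R v)
          ... | inj₂ rv = 0F , λ u a _ → true≢false (proj₁ (restrict-split G R v u a)) rv
          ... | inj₁ rv with ∨-cases {W v} rv
          ...   | inj₁ w = ⊥-elim (true≢false (∨-out w) pv)
          ...   | inj₂ (wv , hv) with common-once wv
          ...     | δ , once = unseen G₁ bound₁ c v (hi s₀) γ δ λ u u′ a a′ ne q q′ →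
              let _ , ru , vu = restrict-split G R v u a
                  _ , ru′ , vu′ = restrict-split G R v u′ a′
              in restrict-pair G R u u′ ru ru′ (join ne vu vu′ (near ru vu q) (near ru′ vu′ q′))
            where
            fv : f ~ v
            fv = split f v id λ f≁v → ⊥-elim (true≢false (∨-in {W v} (∧-pair hv (not-false f≁v))) pv)
            agree-out : ∀ {u} → W u ≡ false → c u ≡ c₀ u
            agree-out {u} w = trans (agree u (∨-out w)) (c₁-out w)
            near : ∀ {u} → R u ≡ true → v ~ u → ¬ Among (hi s₀) γ δ (c u) → u ≡ f ⊎ u ~ f
            near {u} ru vu q with ∨-cases {W u} ru
            ... | inj₂ (wu , hu) = inj₂ (split u f id λ u≁f →
              ⊥-elim (q (inj₁ (trans (agree u (∨-in {W u} (∧-pair hu (not-false (≁sym u≁f))))) (c₁-in wu)))))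
            ... | inj₁ wu with attached-neighbour (H⇒C hv) wu vu
            ...   | inj₁ e = inj₁ e
            ...   | inj₂ (inj₁ a) = ⊥-elim (q (inj₂ (inj₁ (trans (agree-out wu) (γ-other u a)))))
            ...   | inj₂ (inj₂ co) = ⊥-elim (q (inj₂ (inj₂ (trans (agree-out wu) (once u co vu)))))
            join : ∀ {u u′} → u ≢ u′ → v ~ u → v ~ u′ → u ≡ f ⊎ u ~ f → u′ ≡ f ⊎ u′ ~ f → u ~ u′
            join ne _ _ (inj₁ refl) (inj₁ refl) = ⊥-elim (ne refl)
            join ne _ _ (inj₁ refl) (inj₂ b) = ~sym b
            join ne _ _ (inj₂ a) (inj₁ refl) = a
            join ne vu vu′ (inj₂ a) (inj₂ b) = ◇ fv (~sym a) vu (~sym b) vu′ ne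

          few-good : ∃ (Good w₀)
          few-good with extend G₁ c₁ P proper₁ free₁
          ... | c , proper , agree = finish c
            (λ u v hu hv uv → proper u v (restrict-pair G R u v (∨-in {W u} hu) (∨-in {W v} hv) uv))
            λ v hv u wu vu e → proper v u (restrict-pair G R v u (∨-in {W v} hv) (∨-out wu) vu)
              (≡.sym (trans (trans (agree u (∨-out wu)) (c₁-out wu)) e))

        -- If a colour absent from the common neighbours is borne by no attached vertex but x, it serves for
        -- the non-neighbours of x. Otherwise there are six pairwise non-adjacent attached vertices.
        module Many {s₁ x₁ x₂} (att₁ : Att s₁ x₁) (att₂ : Att s₁ x₂) (x₁≢x₂ : x₁ ≢ x₂) where

          -- A triangle vertex missed by an attached vertex would be a spoke. So `x₁` and `x₂` both
          -- see `a` and `b`, hence are adjacent, and then `a` and `κ s₁` are common neighbours of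
          -- that edge.
          noC₃ : ∀ {a b c} → H a ≡ true → H b ≡ true → H c ≡ true → a ~ b → b ~ c → a ~ c → ⊥
          noC₃ {a} {b} {c} ha hb hc ab bc ac = true≢false
            (~sym (◇ (◇ ab (~sym (x~a att₁)) (~sym (x~b att₁)) (~sym (x~a att₂)) (~sym (x~b att₂)) x₁≢x₂)
              (x~a att₁) (x~a att₂) (~sym (proj₁ (proj₁ att₁))) (~sym (proj₁ (proj₁ att₂)))
              λ { refl → true≢false (~sym (κκ s₁)) (W⇒≁ (C⇒W (H⇒C ha)) (not s₁)) }))
            (W⇒≁ (C⇒W (H⇒C ha)) s₁)
            where
            Ca = H⇒C ha ; Cb = H⇒C hb ; Cc = H⇒C hc
            x~a : ∀ {s x} → Att s x → x ~ a
            x~a {x = x} att = split x a id λ xa → ⊥-elim (proj₂ (H⇒ ha) (case dominated att Ca of λ where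
              (inj₁ xa~) → ⊥-elim (true≢false xa~ xa)
              (inj₂ (w , cw , xw , wa)) → split x b
                (λ xb → spoke att Ca Cb Cc (~sym ab) (~sym ac) bc xb xa)
                (λ xb → spoke att Ca cw Cb wa (~sym ab)
                  (short (proj₁ att) (C⇒W cw) (C⇒W Ca) (C⇒W Cb) xw wa ab xa xb) xw xa)))
            x~b : ∀ {s x} → Att s x → x ~ b
            x~b {x = x} att = split x b id λ xb → ⊥-elim (proj₂ (H⇒ hb)
              (spoke att Cb Ca Cc ab (~sym bc) ac (x~a att) xb))

          near : Fin n → Fin n → Bool
          near x v = H v ∧ adj G x v

          -- By diamond-freeness two neighbours of `v` in this set would form a triangle of `H` with
          -- it, so the set induces a matching.
          near-colouring : ∀ {s x} → Att s x → Colorable (restrict G (near x)) 2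
          near-colouring {s} {x} att = two-colour (restrict G (near x)) λ v a b va vb a≢b →
            let nv , na , va~ = restrict-split G (near x) v a va
                _  , nb , vb~ = restrict-split G (near x) v b vb
                hv , xv = ∧-split {H v} nv
                ha , xa = ∧-split {H a} na
                hb , xb = ∧-split {H b} nb
            in noC₃ hv ha hb va~ (◇ xv xa va~ xb vb~ a≢b) vb~

          embed : Fin 2 → Colour
          embed 0F = 0F
          embed 1F = 1F

          embed-injective : ∀ i j → embed i ≡ embed j → i ≡ j
          embed-injective 0F 0F _ = refl
          embed-injective 1F 1F _ = refl
          embed-injective 0F 1F ()
          embed-injective 1F 0F ()

          outer-embed : ∀ {v u} → H v ≡ true → W u ≡ false → v ~ u → ∀ i → c₀ u ≢ embed i
          outer-embed hv wu vu i with outside (H⇒C hv) vu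
          outer-embed hv wu vu i  | inj₁ cu = λ _ → true≢false (C⇒W cu) wu
          outer-embed hv wu vu 0F | inj₂ (_ , ≢0 , _) = ≢0
          outer-embed hv wu vu 1F | inj₂ (_ , _ , ≢1) = ≢1

          two-good : (b : Fin n → Fin 2) →
            (∀ u v → H u ≡ true → H v ≡ true → u ~ v → b u ≢ b v) → ∃ (Good w₀)
          two-good b proper = finish (embed ∘ b)
            (λ u v hu hv uv e → proper u v hu hv uv (embed-injective (b u) (b v) e))
            λ v hv u wu vu → outer-embed hv wu vu (b v)

          Unique : Colour → Fin n → Set
          Unique γ x = ∀ {s′ x′} → Att s′ x′ → c₀ x′ ≡ γ → x′ ≡ x

          unique-good : ∀ γ → (∀ i → embed i ≢ γ) → (∀ {u} → Common u → c₀ u ≢ γ) →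
            ∀ {s x} → Att s x → Unique γ x → ∃ (Good w₀)
          unique-good γ ≢γ common≢γ {s} {x} att uniq = finish col inner outer
            where
            near-col = near-colouring att
            col : Fin n → Colour
            col v = if adj G x v then embed (proj₁ near-col v) else γ
            inner : ∀ u v → H u ≡ true → H v ≡ true → u ~ v → col u ≢ col v
            inner u v hu hv uv e = split x u
              (λ xu → split x v
                (λ xv → proj₂ near-col u v (restrict-pair G (near x) u v (∧-pair hu xu) (∧-pair hv xv) uv)
                  (embed-injective _ _ (trans (≡.sym (if-true xu)) (trans e (if-true xv)))))
                (λ xv → ≢γ _ (trans (≡.sym (if-true xu)) (trans e (if-false xv)))))
              (λ xu → split x v
                (λ xv → ≢γ _ (trans (≡.sym (if-true xv)) (trans (≡.sym e) (if-false xu))))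
                (λ xv → H-independent att hu hv uv xu xv))
            outer : ∀ v → H v ≡ true → ∀ u → W u ≡ false → v ~ u → c₀ u ≢ col v
            outer v hv u wu vu e = split x v
              (λ xv → outer-embed hv wu vu _ (trans e (if-true xv)))
              (λ xv → case neighbour (H⇒C hv) vu of λ where
                (inj₁ cu) → true≢false (C⇒W cu) wu
                (inj₂ (inj₂ co)) → common≢γ co (trans e (if-false xv))
                (inj₂ (inj₁ (s′ , a))) → true≢false (~sym vu)
                  (subst (λ z → z ≁ v) (≡.sym (uniq a (trans e (if-false xv)))) xv))

          Pair : Bool → Colour → Set
          Pair s γ = ∃ λ x → ∃ λ y → Att s x × Att s y × c₀ x ≡ γ × c₀ y ≡ γ × x ≢ y

          SideOf : Colour → Bool → Set
          SideOf γ s = ∀ {s′ x} → Side s′ x → c₀ x ≡ γ → s′ ≡ s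

          pair : ∀ {γ s} → SideOf γ s → ¬ (∃ λ s → ∃ λ x → Att s x × Unique γ x) → ¬ ¬ Pair s γ
          pair {γ} {s} only none =
            -- A colour with no bearer is vacuously `Unique` too. The first call therefore only
            -- produces some bearer, and the second a different one.
            another att₁ >>= λ (s₂ , y , ay , cy , _) →
            another ay >>= λ (s₃ , z , az , cz , z≢y) →
            return (z , y , on az cz , on ay cy , cz , cy , z≢y)
            where
            on : ∀ {s′ x} → Att s′ x → c₀ x ≡ γ → Att s x
            on {x = x} a e = subst (λ t → Att t x) (only (proj₁ a) e) a
            another : ∀ {s x} → Att s x → ¬ ¬ (∃ λ s′ → ∃ λ y → Att s′ y × c₀ y ≡ γ × y ≢ x)
            another {s} {x} a ¬y = none (s , x , a , λ {s′} {x′} a′ e →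
              decidable-stable (x′ ≟ x) λ ne → ¬y (s′ , x′ , a′ , e , ne))

          hi-true-side : SideOf (hi true) true
          hi-true-side {true}  _ _ = refl
          hi-true-side {false} sx e with side-bound sx
          ... | inj₁ e′ = case trans (≡.sym e′) e of λ ()
          ... | inj₂ e′ = case trans (≡.sym e′) e of λ ()

          lo-false-side : SideOf (lo false) false
          lo-false-side {false} _ _ = refl
          lo-false-side {true}  sx e with side-bound sx
          ... | inj₁ e′ = case trans (≡.sym e′) e of λ ()
          ... | inj₂ e′ = case trans (≡.sym e′) e of λ ()

          hi-false-side : SideOf (hi false) false
          hi-false-side {false} _ _ = refl
          hi-false-side {true}  sx e with side-bound sx
          ... | inj₁ e′ = case trans (≡.sym e′) e of λ ()
          ... | inj₂ e′ = case trans (≡.sym e′) e of λ ()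

          -- A vertex of `H` seeing both `x` and `y` would see `κ s`. So the neighbours of `x` are
          -- non-neighbours of `y` and hence independent, as are the non-neighbours of `x`.
          adjacent-good : ∀ {s x y} → Att s x → Att s y → x ~ y → ∃ (Good w₀)
          adjacent-good {s} {x} {y} ax ay xy = two-good (λ v → if adj G x v then 0F else 1F) λ u v hu hv uv e →
            split x u
              (λ xu → split x v
                (λ xv → H-independent ay hu hv uv (apart hu xu) (apart hv xv))
                (λ xv → case trans (≡.sym (if-true xu)) (trans e (if-false xv)) of λ ()))
              (λ xu → split x v
                (λ xv → case trans (≡.sym (if-true xv)) (trans (≡.sym e) (if-false xu)) of λ ())
                (λ xv → H-independent ax hu hv uv xu xv))
            where
            apart : ∀ {v} → H v ≡ true → x ~ v → y ≁ v
            apart hv xv = ≁-intro λ yv → true≢false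
              (~sym (◇ xy xv yv (~sym (proj₁ (proj₁ ax))) (~sym (proj₁ (proj₁ ay)))
                λ { refl → true≢false (~sym (κκ s)) (W⇒≁ (C⇒W (H⇒C hv)) (not s)) }))
              (W⇒≁ (C⇒W (H⇒C hv)) s)

          dominating-good : ∀ {s x} → Att s x → (∀ c → C c → x ~ c) → ∃ (Good w₀)
          dominating-good {s} {x} att all = two-good (proj₁ near-col) λ u v hu hv uv →
            proj₂ near-col u v (restrict-pair G (near x) u v (∧-pair hu (all u (H⇒C hu))) (∧-pair hv (all v (H⇒C hv))) uv)
            where
            near-col = near-colouring att

          module Six
            (independent-sides : ∀ {s x y} → Att s x → Att s y → x ≁ y)
            (none-dominates : ∀ {s x} → Att s x → ¬ (∀ c → C c → x ~ c)) where

            -- The neighbour `y` of `f` on its own side is not attached, and if `f` sees `g` then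
            -- `y` misses `g`. As `g` does not dominate `C`, some induced path `g`, `c`, `d` enters
            -- it, and `y`, `k₁`, `k₂`, `g`, `c`, `d` is a P₆.
            crowded-apart : ∀ {f g} → Att true f → c₀ f ≡ hi true → Att false g → f ≁ g
            crowded-apart {f} {g} af@(Sf , _) cf ag@(Sg , _) = ≁-intro λ fg → case side₀ Sf of λ where
              (inj₁ e) → case trans (≡.sym e) cf of λ ()
              (inj₂ (_ , y , Sy , yf)) →
                let y≁ : ∀ {c} → C c → y ≁ c
                    y≁ cc = ≁-intro λ yc → true≢false yf (independent-sides (Sy , _ , cc , yc) af)
                    y≁g : y ≁ g
                    y≁g = ≁-intro λ yg → true≢false
                      (~sym (◇ yf yg fg (~sym (proj₁ Sy)) (~sym (proj₁ Sf)) (proj₂ (proj₂ Sg))))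
                      (proj₁ (proj₂ Sg))
                in none-dominates ag λ d cd → split g d id λ gd → ⊥-elim (case dominated ag cd of λ where
                  (inj₁ gd~) → true≢false gd~ gd
                  (inj₂ (c , cc , gc , cd~)) → p₆ (~sym (proj₁ Sy)) k₁k₂ (proj₁ Sg) gc cd~
                    (≁sym (proj₁ (proj₂ Sy))) y≁g (y≁ cc) (y≁ cd)
                    (proj₁ (proj₂ Sg)) (W⇒≁ (C⇒W cc) true) (W⇒≁ (C⇒W cd) true)
                    (W⇒≁ (C⇒W cc) false) (W⇒≁ (C⇒W cd) false) gd)

            Apart : Fin n → Fin n → Set
            Apart x y = x ≢ y × x ≁ y

            module _ (xs : List (Fin n)) (len : length xs ≡ 6)
              (att : All (λ x → ∃ λ s → Att s x) xs) (apart : AllPairs Apart xs) where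

              -- Each attached vertex sees both ends of some edge of a 5-cycle; by diamond-freeness no two
              -- non-adjacent ones share such an edge, so there are at most five of them.
              noC₅ : ∀ {a b c d e} → H a ≡ true → H b ≡ true → H c ≡ true → H d ≡ true → H e ≡ true →
                a ~ b → b ~ c → c ~ d → d ~ e → e ~ a → ⊥
              noC₅ {a} {b} {c} {d} {e} ha hb hc hd he ab bc cd de ea =
                clash (pigeonhole (subst (5 <_) (≡.sym len) ≤-refl) λ i → proj₁ (cover (proj₂ (All.lookup att (∈-lookup i)))))
                where
                start end : Fin 5 → Fin n
                start 0F = a ; start 1F = b ; start 2F = c ; start 3F = d ; start 4F = e
                end 0F = b ; end 1F = c ; end 2F = d ; end 3F = e ; end 4F = a
                edge : ∀ i → start i ~ end i
                edge 0F = ab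
                edge 1F = bc
                edge 2F = cd
                edge 3F = de
                edge 4F = ea
                -- Non-neighbours of `x` are independent, so at most two of the five; three
                -- neighbours on a 5-cycle include two consecutive ones.
                cover : ∀ {s x} → Att s x → ∃ λ i → x ~ start i × x ~ end i
                cover {s} {x} at =
                  split x a
                    (λ xa → split x b (λ xb → 0F , xa , xb) λ xb →
                      let xc = must hb hc bc xb in
                      split x d (λ xd → 2F , xc , xd) λ xd → 4F , must hd he de xd , xa)
                    (λ xa → let xb = must ha hb ab xa ; xe = must ha he (~sym ea) xa in
                      split x c (λ xc → 1F , xb , xc) λ xc → 3F , must hc hd cd xc , xe)
                  where
                  must : ∀ {u v} → H u ≡ true → H v ≡ true → u ~ v → x ≁ u → x ~ v
                  must {u} {v} hu hv uv xu = split x v id λ xv → ⊥-elim (H-independent at hu hv uv xu xv)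
                clash : (∃ λ i → ∃ λ j → i <ᶠ j × proj₁ (cover (proj₂ (All.lookup att (∈-lookup {xs = xs} i)))) ≡
                  proj₁ (cover (proj₂ (All.lookup att (∈-lookup {xs = xs} j))))) → ⊥
                clash (i , j , i<j , eq) with cover (proj₂ (All.lookup att (∈-lookup {xs = xs} i))) | cover (proj₂ (All.lookup att (∈-lookup {xs = xs} j)))
                clash (i , j , i<j , refl) | m , si , ei | _ , sj , ej =
                  let ne , na = pairwise apart i j i<j in
                  true≢false (◇ (edge m) (~sym si) (~sym ei) (~sym sj) (~sym ej) ne) na

              six-good : ¬ ¬ ∃ (Good w₀)
              six-good = bipartite G p₆ H noC₃ noC₅ >>= λ (b , proper) →
                return (two-good (λ v → if b v then 0F else 1F) λ u v hu hv uv e → proper u v hu hv uv (bit (b u) (b v) e))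
                where
                bit : ∀ a b → (if a then 0F else 1F) ≡ (Fin 2 ∋ (if b then 0F else 1F)) → a ≡ b
                bit true  true  _ = refl
                bit false false _ = refl

            -- These are the three private colours that common neighbours never bear. Only `hi true`
            -- comes from the first side, so `crowded-apart` settles every pair across the sides.
            pairs-good : Pair true (hi true) → Pair false (lo false) → Pair false (hi false) → ¬ ¬ ∃ (Good w₀)
            pairs-good (f , f′ , af , af′ , cf , cf′ , f≢) (g , g′ , ag , ag′ , cg , cg′ , g≢) (h , h′ , ah , ah′ , ch , ch′ , h≢) =
              six-good (f ∷ f′ ∷ g ∷ g′ ∷ h ∷ h′ ∷ []) refl
                ((_ , af) ∷ (_ , af′) ∷ (_ , ag) ∷ (_ , ag′) ∷ (_ , ah) ∷ (_ , ah′) ∷ [])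
                ( ((f≢ , independent-sides af af′) ∷ across af cf ag ∷ across af cf ag′ ∷ across af cf ah ∷ across af cf ah′ ∷ [])
                ∷ (across af′ cf′ ag ∷ across af′ cf′ ag′ ∷ across af′ cf′ ah ∷ across af′ cf′ ah′ ∷ [])
                ∷ ((g≢ , independent-sides ag ag′) ∷ level ag ah cg ch ∷ level ag ah′ cg ch′ ∷ [])
                ∷ (level ag′ ah cg′ ch ∷ level ag′ ah′ cg′ ch′ ∷ [])
                ∷ ((h≢ , independent-sides ah ah′) ∷ [])
                ∷ [] ∷ [])
              where
              across : ∀ {f g} → Att true f → c₀ f ≡ hi true → Att false g → Apart f g
              across af cf ag = separated (~sym (proj₁ (proj₁ af))) (≁sym (proj₁ (proj₂ (proj₁ ag)))) , crowded-apart af cf ag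
              level : ∀ {g h} → Att false g → Att false h → c₀ g ≡ lo false → c₀ h ≡ hi false → Apart g h
              level ag ah cg ch = (λ { refl → case trans (≡.sym cg) ch of λ () }) , independent-sides ag ah

          many-good : ¬ ¬ ∃ (Good w₀)
          many-good =
            try (hi true) (λ { 0F () ; 1F () }) (common≢hi true) λ no₁ →
            try (lo false) (λ { 0F () ; 1F () }) common≢3 λ no₂ →
            try (hi false) (λ { 0F () ; 1F () }) (common≢hi false) λ no₃ →
            em (∃ λ s → ∃ λ x → ∃ λ y → Att s x × Att s y × x ~ y) >>= λ where
              (yes (_ , _ , _ , ax , ay , xy)) → return (adjacent-good ax ay xy)
              (no ¬adj) → em (∃ λ s → ∃ λ x → Att s x × (∀ c → C c → x ~ c)) >>= λ where
                (yes (_ , _ , ax , all)) → return (dominating-good ax all)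
                (no ¬dom) →
                  pair hi-true-side no₁ >>= λ F → pair lo-false-side no₂ >>= λ K → pair hi-false-side no₃ >>= λ L →
                  Six.pairs-good (λ ax ay → ≁-intro λ xy → ¬adj (_ , _ , _ , ax , ay , xy))
                    (λ ax all → ¬dom (_ , _ , ax , all)) F K L
            where
            common≢3 : ∀ {u} → Common u → c₀ u ≢ lo false
            common≢3 cu with common₀ cu
            ... | i , e rewrite e = λ ()
            try : ∀ γ → (∀ i → embed i ≢ γ) → (∀ {u} → Common u → c₀ u ≢ γ) →
              (¬ (∃ λ s → ∃ λ x → Att s x × Unique γ x) → ¬ ¬ ∃ (Good w₀)) → ¬ ¬ ∃ (Good w₀)
            try γ ≢γ common≢γ next = em (∃ λ s → ∃ λ x → Att s x × Unique γ x) >>= λ where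
              (yes (_ , _ , ax , uniq)) → return (unique-good γ ≢γ common≢γ ax uniq)
              (no none) → next none

        one-hub-good : ¬ ¬ ∃ (Good w₀)
        one-hub-good =
          em (∃ λ s → ∃ λ x → ∃ λ y → Att s x × Att s y × x ≢ y) >>= λ where
            (yes (_ , _ , _ , ax , ay , ne)) → Many.many-good ax ay ne
            (no ¬many) → attached >>= λ (s , f , af) →
              let few : ∀ {s x y} → Att s x → Att s y → x ≡ y
                  few {x = x} {y} ax ay = decidable-stable (x ≟ y) λ ne → ¬many (_ , _ , _ , ax , ay , ne)
              in em (∃ (Att (not s))) >>= λ where
                (yes (g , ag)) → return (Few.few-good few af (c₀ g) λ x ax → cong c₀ (few ax ag))
                -- With nothing attached on the other side, `0F` is a dummy.
                (no none) → return (Few.few-good few af 0F λ x ax → ⊥-elim (none (x , ax)))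

      component-good : (∀ v → Dec (C v)) → ¬ ¬ ∃ (Good w₀)
      component-good C? = em TwoHubs >>= λ where
        (yes two@(c , sp , _)) → CliqueCase.clique-good (two-hubs⇒clique two) (Spoke.Cc sp) (Spoke.Ch sp)
          (~⇒≢ (~sym (Spoke.hc sp)))
        (no ¬two) → dec-pred Spoke >>= λ spoke? → OneHub.one-hub-good ¬two C? spoke?

-- Assembling the colouring

colouring-≥3 : (G : Graph n) → NoP₆ G → NoDiamond G → Connected G → ¬ HasCliqueCutset G →
  ∀ {p} → CliqueBound G (3 + p) → HasClique G (3 + p) → ¬ ¬ Colorable G (6 + p)
colouring-≥3 {n} G p₆ ◇ connected noCut {p} bound clique =
  light-edge G p₆ ◇ connected noCut bound clique >>= λ (k₁ , k₂ , k₁k₂ , light₁ , light₂) →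
  build k₁ k₂ k₁k₂ light₁ light₂
  where
  build : ∀ k₁ k₂ → Adj G k₁ k₂ → Light G k₁ k₂ → Light G k₂ k₁ → ¬ ¬ Colorable G (6 + p)
  build k₁ k₂ k₁k₂ light₁ light₂ =
    ¬¬-∀Fin (λ u → dec-pred (PathIn G W u)) >>= λ path? →
    ¬¬-∀Fin (choose-good path?) >>= λ D →
    return (assemble D (patch G W path? (proj₁ ∘ D)))
    where
    open Base G
    open OffEdge G p₆ ◇ connected noCut k₁ k₂ k₁k₂
    open Palette p
    open BaseColouring G p₆ ◇ connected noCut k₁ k₂ k₁k₂ light₁ light₂ bound using (c₀; proper₀; common₀; side₀)
    common-colour : ∀ {v} → Common v → ∃ λ i → c₀ v ≡ 5 ↑ʳ i
    common-colour cv = _ , common₀ cv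
    open ComponentColouring.Over G p₆ ◇ connected noCut k₁ k₂ k₁k₂ bound c₀ proper₀ common-colour side₀

    Chosen : Fin n → Set
    Chosen w = Σ Partial λ D → W w ≡ true → Good w D

    choose-good : (∀ u v → Dec (PathIn G W u v)) → ∀ w → ¬ ¬ Chosen w
    choose-good path? w with true⊎false (W w)
    ... | inj₂ ¬w = return ((λ _ → nothing) , λ ww → ⊥-elim (true≢false ww ¬w))
    ... | inj₁ ww = component-good w ww (path? w) >>= λ (D , good) → return (D , λ _ → good)

    assemble : (D : ∀ w → Chosen w) →
      (Σ Partial λ E → ∀ v → W v ≡ true →
        ∃ λ w → PathIn G W w v × (∀ u → PathIn G W w u → E u ≡ proj₁ (D w) u)) → Colorable G (6 + p)
    assemble D (E , agrees) = proj₁ extended , proj₁ (proj₂ extended)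
      where
      c : Fin n → Colour
      -- The default is harmless: off `P` the colour is replaced by `extend`.
      c u = fromMaybe 0F (onto E u)
      P : Fin n → Bool
      P u = is-just (onto E u)

      coloured : ∀ u → P u ≡ true → onto E u ≡ just (c u)
      coloured u pu with onto E u
      ... | just _ = refl

      just⇒P : ∀ {u a} → onto E u ≡ just a → P u ≡ true × c u ≡ a
      just⇒P {u} e rewrite e = refl , refl

      ¬P⇒W : ∀ v → P v ≡ false → W v ≡ true × onto E v ≡ nothing
      ¬P⇒W v pv with true⊎false (W v)
      ... | inj₂ w = ⊥-elim (true≢false (proj₁ (just⇒P {v} (onto-out E w))) pv)
      ... | inj₁ w = w , empty (onto E v) pv
        where
        empty : (m : Maybe Colour) → is-just m ≡ false → m ≡ nothing
        empty nothing _ = refl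

      local : ∀ v → W v ≡ true → ∃ λ w → PathIn G W w v × Good w (proj₁ (D w)) ×
        E v ≡ proj₁ (D w) v × (∀ u → v ~ u → onto E u ≡ onto (proj₁ (D w)) u)
      local v wv with agrees v wv
      ... | w , pw , ag = w , pw , proj₂ (D w) (path-start pw) , ag v pw , λ u vu → same u vu (true⊎false (W u))
        where
        same : ∀ u → v ~ u → W u ≡ true ⊎ W u ≡ false → onto E u ≡ onto (proj₁ (D w)) u
        same u vu (inj₁ wu) = trans (onto-in E wu) (trans (ag u (path-snoc pw vu wu)) (≡.sym (onto-in (proj₁ (D w)) wu)))
        same u vu (inj₂ wu) = trans (onto-out E wu) (≡.sym (onto-out (proj₁ (D w)) wu))

      proper-in : ∀ u v → W u ≡ true → P u ≡ true → P v ≡ true → u ~ v → c u ≢ c v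
      proper-in u v wu pu pv uv e with local u wu
      ... | w , pw , good , eu , nb = proj₁ (good u pw) (c u)
        (trans (≡.sym eu) (trans (≡.sym (onto-in E wu)) (coloured u pu))) v uv
        (trans (≡.sym (nb v uv)) (trans (coloured v pv) (cong just (≡.sym e))))

      proper : ∀ u v → P u ≡ true → P v ≡ true → u ~ v → c u ≢ c v
      proper u v pu pv uv e with true⊎false (W u) | true⊎false (W v)
      ... | inj₁ wu | _       = proper-in u v wu pu pv uv e
      ... | inj₂ _  | inj₁ wv = proper-in v u wv pv pu (~sym uv) (≡.sym e)
      ... | inj₂ wu | inj₂ wv = proper₀ u v wu wv uv
        (trans (≡.sym (proj₂ (just⇒P {u} (onto-out E wu)))) (trans e (proj₂ (just⇒P {v} (onto-out E wv)))))

      free : ∀ v → P v ≡ false → ∀ d → (∀ u → P u ≡ true → d u ≡ c u) → Unseen G d v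
      free v pv d agree with ¬P⇒W v pv
      ... | wv , ev with local v wv
      ... | w , pw , good , eq , nb
        with proj₂ (good v pw) (trans (≡.sym eq) (trans (≡.sym (onto-in E wv)) ev))
      ... | α , β , δ , low = unseen G bound d v α β δ λ u u′ vu vu′ ne q q′ →
        low u u′ vu vu′ ne (q ∘ back vu) (q′ ∘ back vu′)
        where
        value : ∀ {u a} → v ~ u → onto (proj₁ (D w)) u ≡ just a → d u ≡ a
        value {u} vu e with just⇒P {u} (trans (nb u vu) e)
        ... | pu , cu = trans (agree u pu) cu
        back : ∀ {u} → v ~ u → Among (just α) (just β) (just δ) (onto (proj₁ (D w)) u) → Among α β δ (d u)
        back vu (inj₁ e)        = inj₁ (value vu e)
        back vu (inj₂ (inj₁ e)) = inj₂ (inj₁ (value vu e))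
        back vu (inj₂ (inj₂ e)) = inj₂ (inj₂ (value vu e))

      extended = extend G c P proper free

-- Clique number at most two, and the conclusion

colouring-2 : (G : Graph n) → NoP₆ G → NoDiamond G → Connected G → ¬ HasCliqueCutset G →
  CliqueBound G 2 → HasClique G 2 → ¬ ¬ Colorable G 4
colouring-2 {n} G p₆ ◇ connected noCut bound (k , _ , kk) =
  ¬¬-∀Fin (λ u → dec-pred (PathIn G W u)) >>= λ path? →
  ¬¬-∀Fin choose-att >>= λ x →
  return (assemble x (patch G W path? (λ w → adj G (proj₁ (x w)))))
  where
  open Base G
  k₁k₂ = kk 0F 1F (λ ())
  open OffEdge G p₆ ◇ connected noCut (k 0F) (k 1F) k₁k₂

  triangle-free : ∀ {a b c} → a ~ b → b ~ c → a ~ c → ⊥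
  triangle-free {a} {b} {c} ab bc ac = 1+n≰n (bound (a ◂ b ◂ c ◂ λ ())
    (◂-clique G (λ { 0F → ab ; 1F → ac }) (◂-clique G (λ { 0F → bc }) (◂-clique G (λ ()) λ ()))))

  Chosen : Fin n → Set
  Chosen w = Σ (Fin n) λ x → (ww : W w ≡ true) → ∃ λ s → Component.Att w ww s x

  choose-att : ∀ w → ¬ ¬ Chosen w
  choose-att w with true⊎false (W w)
  ... | inj₂ ¬w = return (w , λ ww → ⊥-elim (true≢false ww ¬w))
  ... | inj₁ ww = Component.attached w ww >>= λ (s , x , a) → return (x , λ _ → s , a)

  assemble : (x : ∀ w → Chosen w) →
    (Σ (Fin n → Bool) λ E → ∀ v → W v ≡ true →
      ∃ λ w → PathIn G W w v × (∀ u → PathIn G W w u → E u ≡ adj G (proj₁ (x w)) u)) → Colorable G 4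
  assemble x (E , agrees) = c , proper
    where
    c : Fin n → Fin 4
    c v = if W v then (if E v then 0F else 1F) else (if adj G (k 0F) v then 2F else 3F)

    -- In a component, colouring by adjacency to one attached `z` is proper: an edge of neighbours
    -- makes a triangle with `z`, and an edge of non-neighbours makes one with the vertex between it
    -- and `z`, by `dominated` and `short`.
    inner : ∀ u v → W u ≡ true → W v ≡ true → u ~ v → E u ≢ E v
    inner u v wu wv uv e with agrees u wu
    ... | w , pu , ag with proj₂ (x w) (path-start pu)
    ... | s , att = split z u
        (λ zu → triangle-free zu uv (trans (≡.sym same) zu))
        (λ zu → case Component.dominated w (path-start pu) att pu of λ where
          (inj₁ zu~) → true≢false zu~ zu
          (inj₂ (y , cy , zy , yu)) → triangle-free yu uv
            (short (proj₁ att) (path-end cy) wu wv zy yu uv zu (trans (≡.sym same) zu)))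
      where
      z = proj₁ (x w)
      same : adj G z u ≡ adj G z v
      same = trans (≡.sym (ag u pu)) (trans e (ag v (path-snoc pu uv wv)))

    low≢high : ∀ a b → (Fin 4 ∋ (if a then 0F else 1F)) ≢ (if b then 2F else 3F)
    low≢high true  true  ()
    low≢high true  false ()
    low≢high false true  ()
    low≢high false false ()

    low-injective : ∀ a b → (Fin 4 ∋ (if a then 0F else 1F)) ≡ (if b then 0F else 1F) → a ≡ b
    low-injective true  true  _ = refl
    low-injective false false _ = refl

    high-injective : ∀ a b → (Fin 4 ∋ (if a then 2F else 3F)) ≡ (if b then 2F else 3F) → a ≡ b
    high-injective true  true  _ = refl
    high-injective false false _ = refl

    k₂-covers : ∀ v → W v ≡ false → k 0F ≁ v → k 1F ~ v
    k₂-covers v w a = split (k 1F) v id λ b → ⊥-elim (true≢false (∧-pair (not-false a) (not-false b)) w)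

    outer : ∀ u v → W u ≡ false → W v ≡ false → u ~ v → adj G (k 0F) u ≢ adj G (k 0F) v
    outer u v wu wv uv e = split (k 0F) u
      (λ a → triangle-free a uv (trans (≡.sym e) a))
      (λ a → triangle-free (k₂-covers u wu a) uv (k₂-covers v wv (trans (≡.sym e) a)))

    proper : ∀ u v → u ~ v → c u ≢ c v
    proper u v uv e with true⊎false (W u) | true⊎false (W v)
    ... | inj₁ wu | inj₁ wv = inner u v wu wv uv
      (low-injective _ _ (trans (≡.sym (if-true wu)) (trans e (if-true wv))))
    ... | inj₂ wu | inj₂ wv = outer u v wu wv uv
      (high-injective _ _ (trans (≡.sym (if-false wu)) (trans e (if-false wv))))
    ... | inj₁ wu | inj₂ wv = low≢high _ _ (trans (≡.sym (if-true wu)) (trans e (if-false wv)))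
    ... | inj₂ wu | inj₁ wv = low≢high _ _ (trans (≡.sym (if-true wv)) (trans (≡.sym e) (if-false wu)))

colouring-1 : (G : Graph n) → CliqueBound G 1 → Colorable G 1
colouring-1 G bound = (λ _ → 0F) , λ u v uv _ → 1+n≰n (bound (u ◂ v ◂ λ ())
  (◂-clique G (λ { 0F → uv }) (◂-clique G (λ ()) λ ())))

theorem4p2 : ∀ {n} (G : Graph n) →
    Connected G → ¬ HasCliqueCutset G → ¬ HasComparablePair G →
    Free₂ P6 diamond G → ¬ Perfect G →
    ∀ χ ω → IsChromaticNumber G χ → IsCliqueNumber G ω → χ ≤ ω + 3
theorem4p2 G connected noCut _ (p6-free , diamond-free) _ χ ω (_ , least) (clique , largest) =
  decidable-stable (χ ≤? ω + 3) (by-clique-number ω clique (cliqueBound {G = G} largest))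
  where
  p₆ = noP₆ G p6-free
  ◇ : NoDiamond G
  ◇ = noDiamond G diamond-free
  by-clique-number : ∀ ω → HasClique G ω → CliqueBound G ω → ¬ ¬ (χ ≤ ω + 3)
  by-clique-number 0 _ bound = return (≤-trans (least 1 (colouring-1 G λ f a → m≤n⇒m≤1+n (bound f a))) (s≤s z≤n))
  by-clique-number 1 _ bound = return (≤-trans (least 1 (colouring-1 G bound)) (s≤s z≤n))
  by-clique-number 2 K bound = colouring-2 G p₆ ◇ connected noCut bound K >>= λ c →
    return (m≤n⇒m≤1+n (least 4 c))
  by-clique-number (suc (suc (suc p))) K bound = colouring-≥3 G p₆ ◇ connected noCut bound K >>= λ c →
    return (subst (χ ≤_) (+-comm 3 (3 + p)) (least (6 + p) c))
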